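{- For every composition $\alpha=(\alpha_1,\dots,\alpha_s)$ with $\alpha_1,\alpha_s\ge2$, the map $$\phi:\{\mathcal O\mid \mathcal O\text{ an orbit of rowmotion on antichains of }\breve F(\alpha)\}\to\{T\mid T\text{ an }\alpha\text{ -tiling}\}$$ (with $\alpha$-tilings considered up to horizontal translation) is a (well-defined) bijection.
   Context: Fences. Put $p_0=0$, $p_i=\alpha_1+\dots+\alpha_i$ and $n=p_s-1$. The fence $\breve F(\alpha)$ is the poset on $\{x_1,\dots,x_n\}$ with covering relations, for $1\le k<n$ and $i$ such that $p_{i-1}\le k<p_i$: $x_k\lhd x_{k+1}$ if $i$ is odd, and $x_k\rhd x_{k+1}$ if $i$ is even. The $i$th segment $S_i$ is the chain of the $x_k$ with $p_{i-1}\le k\le p_i$, $1\le k\le n$. An element is shared if it lies in two segments (these are the $x_{p_i}$, $1\le i\le s-1$, with $x_{p_i}\in S_i\cap S_{i+1}$), and unshared otherwise; $S_i$ has $\alpha_i-1$ unshared elements. Rowmotion. Rowmotion on antichains is the bijection $\rho$ sending an antichain $A$ to the set of minimal elements of the complement of the (lower order) ideal generated by $A$; orbits are those of the cyclic group generated by $\rho$. Tilings. $H_s$ is the horizontal strip of unit squares with rows $1,\dots,s$ (top to bottom) and columns indexed by $\mathbb Z$ (left to right). An $a\times b$ tile covers $a$ rows and $b$ columns. An $\alpha$-tiling is a tiling of $H_s$ using yellow $1\times1$ tiles, red $2\times1$ tiles, and black $1\times(\alpha_i-1)$ tiles in row $i$, $1\le i\le s$ (so no black tiles in row $i$ if $\alpha_i=1$),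 such that for all rows: (a) if $\alpha_i>1$ and the red tiles are ignored, then the black and yellow tiles alternate in row $i$; (b) there is a red tile in a column covering rows $i$ and $i+1$ if and only if either the previous column contains two yellow tiles in those two rows when $i$ is even, or the next column contains two yellow tiles in those two rows when $i$ is odd. Two tilings are the same if one is a horizontal translate of the other. The map $\phi$. Given an orbit $\mathcal O$, pick $A\in\mathcal O$ and let column $k\in\mathbb Z$ correspond to the antichain $\rho^k(A)$. Color the square in row $i$ of column $k$ yellow, red or black according to whether $S_i\cap\rho^k(A)$ is empty, a shared element, or an unshared element, respectively. Red squares form $2\times 1$ tiles: a shared element of $S_i\cap S_{i+1}$ in $\rho^k(A)$ gives a red tile in column $k$ covering rows $i,i+1$. The black squares in row $i$ are grouped into $1\times(\alpha_i-1)$ tiles so that the $j$th square of a tile corresponds to the $j$th smallest unshared element of $S_i$. The result, up to translation, is $\phi(\mathcal O)$. -}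

module Defs where

open import Data.Fin using (Fin; zero; suc; toℕ; fromℕ; fromℕ<; inject₁)
open import Data.Fin.Induction using (po-wellFounded)
open import Data.Fin.Properties using (any?; all?; toℕ-injective; toℕ<n; toℕ-fromℕ<) renaming (_≟_ to _≟ᶠ_)
open import Data.Fin.Subset using (Subset; _∈_)
open import Data.Fin.Subset.Properties using (_∈?_; ⊆-antisym)
open import Data.Integer as ℤ using (ℤ; +_; -[1+_])
import Data.Integer.Properties as ℤ
open import Data.Nat using (ℕ; zero; suc; _+_; _∸_; _≤_; _<_; s≤s; parity)
open import Data.Nat.Properties
open import Data.Parity.Base using (0ℙ; 1ℙ)
open import Data.Parity.Properties using () renaming (_≟_ to _≟ℙ_)
open import Data.Product using (Σ; ∃-syntax; ∃!; _×_; _,_; proj₁; proj₂)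
open import Data.Sum using (_⊎_; inj₁; inj₂)
open import Data.Vec using (tabulate)
open import Data.Vec.Properties using (lookup∘tabulate; []=⇒lookup; lookup⇒[]=)
open import Function using (_∘_; flip; case_of_; _⇔_; mk⇔; Equivalence)
open import Induction.WellFounded using (Acc; acc)
open import Level using (0ℓ) renaming (suc to lsuc)
open import Relation.Binary using (Rel; Setoid; IsDecPartialOrder; Decidable)
open import Relation.Binary.Construct.Closure.ReflexiveTransitive using (Star; ε; _◅_; _◅◅_)
import Relation.Binary.Construct.Flip.EqAndOrd as Flip
open import Relation.Binary.PropositionalEquality
open import Relation.Nullary using (¬_; Dec; yes; no; does; contradiction; ¬?; recompute)
open import Relation.Nullary.Decidable using (_×-dec_; _⊎-dec_; _→-dec_; map′; decidable-stable; dec-true)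
open import Relation.Unary using (Pred) renaming (Decidable to Decidable₁; _∈_ to _∈ᵖ_)

subsetOf : ∀ {n} {P : Pred (Fin n) 0ℓ} → Decidable₁ P → Subset n
subsetOf P? = tabulate (does ∘ P?)

∈-subsetOf⁺ : ∀ {n} {P : Pred (Fin n) 0ℓ} (P? : Decidable₁ P) {x} → P x → x ∈ subsetOf P?
∈-subsetOf⁺ P? {x} px =
  lookup⇒[]= x _ (trans (lookup∘tabulate (does ∘ P?) x) (dec-true (P? x) px))

∈-subsetOf⁻ : ∀ {n} {P : Pred (Fin n) 0ℓ} (P? : Decidable₁ P) {x} → x ∈ subsetOf P? → P x
∈-subsetOf⁻ P? {x} x∈ with P? x | trans (sym (lookup∘tabulate (does ∘ P?) x)) ([]=⇒lookup x∈)
... | yes px | _  = px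
... | no  _  | ()

IsAntichain : ∀ {n} → Rel (Fin n) 0ℓ → Subset n → Set
IsAntichain _⊑_ A = ∀ {x y} → x ∈ A → y ∈ A → x ⊑ y → x ≡ y

module Poset {n} {_⊑_ : Rel (Fin n) 0ℓ} (O : IsDecPartialOrder _≡_ _⊑_) where

  private module O = IsDecPartialOrder O

  InIdeal : Subset n → Pred (Fin n) 0ℓ
  InIdeal A y = ∃[ x ] x ∈ A × y ⊑ x

  inIdeal? : ∀ A → Decidable₁ (InIdeal A)
  inIdeal? A y = any? λ x → x ∈? A ×-dec y O.≤? x

  Minimal : Pred (Fin n) 0ℓ → Pred (Fin n) 0ℓ
  Minimal P x = P x × (∀ y → P y → y ⊑ x → y ≡ x)

  minimal? : ∀ {P} → Decidable₁ P → Decidable₁ (Minimal P)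
  minimal? P? x = P? x ×-dec all? λ y → P? y →-dec (y O.≤? x →-dec y ≟ᶠ x)

  OutsideIdeal : Subset n → Pred (Fin n) 0ℓ
  OutsideIdeal A y = ¬ InIdeal A y

  outsideIdeal? : ∀ A → Decidable₁ (OutsideIdeal A)
  outsideIdeal? A y = ¬? (inIdeal? A y)

  step : Subset n → Subset n
  step A = subsetOf (minimal? (outsideIdeal? A))

  step-antichain : ∀ A → IsAntichain _⊑_ (step A)
  step-antichain A x∈ y∈ x⊑y =
    proj₂ (∈-subsetOf⁻ (minimal? (outsideIdeal? A)) y∈) _
      (proj₁ (∈-subsetOf⁻ (minimal? (outsideIdeal? A)) x∈)) x⊑y

  minimal-below : ∀ {P} → Decidable₁ P → ∀ {y} → P y → ∃[ m ] Minimal P m × m ⊑ y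
  minimal-below {P} P? = go (po-wellFounded O.isPartialOrder _)
    where
    go : ∀ {y} → Acc _ y → P y → ∃[ m ] Minimal P m × m ⊑ y
    go {y} (acc rs) py with any? (λ z → P? z ×-dec (z O.≤? y ×-dec ¬? (z ≟ᶠ y)))
    ... | yes (z , pz , z⊑y , z≢y) =
          let m , min , m⊑z = go (rs (z⊑y , z≢y)) pz in m , min , O.trans m⊑z z⊑y
    ... | no none = y , (py , λ z pz z⊑y →
          decidable-stable (z ≟ᶠ y) λ z≢y → none (z , pz , z⊑y , z≢y)) , O.refl

dual : ∀ {n} {_⊑_ : Rel (Fin n) 0ℓ} →
       IsDecPartialOrder _≡_ _⊑_ → IsDecPartialOrder _≡_ (flip _⊑_)
dual O = record
  { isPartialOrder = Flip.isPartialOrder O.isPartialOrder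
  ; _≟_            = O._≟_
  ; _≤?_           = λ x y → y O.≤? x
  } where module O = IsDecPartialOrder O

dual-step : ∀ {n} {_⊑_ : Rel (Fin n) 0ℓ} (O : IsDecPartialOrder _≡_ _⊑_) {A : Subset n} →
            IsAntichain _⊑_ A → Poset.step (dual O) (Poset.step O A) ≡ A
dual-step {_⊑_ = _⊑_} O {A} anti = ⊆-antisym fwd bwd
  where
  module O = IsDecPartialOrder O
  module P = Poset O
  module D = Poset (dual O)

  U? = P.minimal? (P.outsideIdeal? A)
  V? = D.minimal? (D.outsideIdeal? (P.step A))

  to : ∀ {y} → D.OutsideIdeal (P.step A) y → P.InIdeal A y
  to {y} out = decidable-stable (P.inIdeal? A y) λ y∉ →
    let m , min , m⊑y = P.minimal-below (P.outsideIdeal? A) y∉ in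
    out (m , ∈-subsetOf⁺ U? min , m⊑y)

  from : ∀ {y} → P.InIdeal A y → D.OutsideIdeal (P.step A) y
  from (a , a∈ , y⊑a) (x , x∈ , x⊑y) =
    proj₁ (∈-subsetOf⁻ U? x∈) (a , a∈ , O.trans x⊑y y⊑a)

  fwd : ∀ {x} → x ∈ D.step (P.step A) → x ∈ A
  fwd {x} x∈ with ∈-subsetOf⁻ V? x∈
  ... | out , max with to out
  ...   | a , a∈ , x⊑a = subst (_∈ A) (max a (from (a , a∈ , O.refl)) x⊑a) a∈

  bwd : ∀ {x} → x ∈ A → x ∈ D.step (P.step A)
  bwd {x} x∈ = ∈-subsetOf⁺ V? (from (x , x∈ , O.refl) , λ y out x⊑y → below y (to out) x⊑y)
    where
    below : ∀ y → P.InIdeal A y → x ⊑ y → y ≡ x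
    below y (a , a∈ , y⊑a) x⊑y with anti x∈ a∈ (O.trans x⊑y y⊑a)
    ... | refl = O.antisym y⊑a x⊑y

module Rowmotion {n} {_⊑_ : Rel (Fin n) 0ℓ} (O : IsDecPartialOrder _≡_ _⊑_) where

  -- The proof field is irrelevant, so antichains with the same elements are equal.
  record Antichain : Set where
    constructor ⟨_,_⟩
    field
      elements     : Subset n
      .isAntichain : IsAntichain _⊑_ elements

  open Antichain public

  antichain : (A : Antichain) → IsAntichain _⊑_ (elements A)
  antichain ⟨ _ , anti ⟩ {x} {y} x∈ y∈ x⊑y = recompute (x ≟ᶠ y) (anti x∈ y∈ x⊑y)

  elements-injective : ∀ {A B} → elements A ≡ elements B → A ≡ B
  elements-injective refl = refl

  ρ : Antichain → Antichain
  ρ A = ⟨ Poset.step O (elements A) , Poset.step-antichain O (elements A) ⟩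

  -- The inverse of ρ is rowmotion of the dual poset: the maximal elements of
  -- the complement of the filter generated by A.
  ρ⁻¹ : Antichain → Antichain
  ρ⁻¹ A = ⟨ Poset.step (dual O) (elements A)
          , (λ x∈ y∈ x⊑y → sym (Poset.step-antichain (dual O) (elements A) y∈ x∈ x⊑y)) ⟩

  ρ⁻¹∘ρ : ∀ A → ρ⁻¹ (ρ A) ≡ A
  ρ⁻¹∘ρ A = elements-injective (dual-step O (antichain A))

  ρ∘ρ⁻¹ : ∀ A → ρ (ρ⁻¹ A) ≡ A
  ρ∘ρ⁻¹ A = elements-injective
    (dual-step (dual O) λ x∈ y∈ y⊑x → sym (antichain A y∈ x∈ y⊑x))

  ρ^ : ℤ → Antichain → Antichain
  ρ^ (+ zero)       A = A
  ρ^ (+ suc k)      A = ρ (ρ^ (+ k) A)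
  ρ^ -[1+ zero ]    A = ρ⁻¹ A
  ρ^ -[1+ suc k ]   A = ρ⁻¹ (ρ^ -[1+ k ] A)

  ρ^-suc : ∀ k A → ρ^ (ℤ.suc k) A ≡ ρ (ρ^ k A)
  ρ^-suc (+ k)          A = refl
  ρ^-suc -[1+ zero ]    A = sym (ρ∘ρ⁻¹ A)
  ρ^-suc -[1+ suc k ]   A = sym (ρ∘ρ⁻¹ _)

  ρ^-pred : ∀ k A → ρ^ (ℤ.pred k) A ≡ ρ⁻¹ (ρ^ k A)
  ρ^-pred (+ zero)     A = refl
  ρ^-pred (+ suc k)    A = sym (ρ⁻¹∘ρ _)
  ρ^-pred -[1+ k ]     A = refl

  ρ^-+ : ∀ j k A → ρ^ (j ℤ.+ k) A ≡ ρ^ j (ρ^ k A)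
  ρ^-+ (+ zero)       k A = cong (λ i → ρ^ i A) (ℤ.+-identityˡ k)
  ρ^-+ (+ suc j)      k A = begin
    ρ^ (+ suc j ℤ.+ k) A       ≡⟨ cong (λ i → ρ^ i A) (ℤ.suc-+ j k) ⟩
    ρ^ (ℤ.suc (+ j ℤ.+ k)) A     ≡⟨ ρ^-suc (+ j ℤ.+ k) A ⟩
    ρ (ρ^ (+ j ℤ.+ k) A)       ≡⟨ cong ρ (ρ^-+ (+ j) k A) ⟩
    ρ (ρ^ (+ j) (ρ^ k A))      ∎ where open ≡-Reasoning
  ρ^-+ -[1+ zero ]    k A = ρ^-pred k A
  ρ^-+ -[1+ suc j ]   k A = begin
    ρ^ (-[1+ suc j ] ℤ.+ k) A      ≡⟨ cong (λ i → ρ^ i A) (ℤ.pred-+ -[1+ j ] k) ⟩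
    ρ^ (ℤ.pred (-[1+ j ] ℤ.+ k)) A   ≡⟨ ρ^-pred (-[1+ j ] ℤ.+ k) A ⟩
    ρ⁻¹ (ρ^ (-[1+ j ] ℤ.+ k) A)    ≡⟨ cong ρ⁻¹ (ρ^-+ -[1+ j ] k A) ⟩
    ρ⁻¹ (ρ^ -[1+ j ] (ρ^ k A))   ∎ where open ≡-Reasoning

  -- Orbits of the cyclic group generated by ρ, represented by their members.
  Orbits : Setoid 0ℓ 0ℓ
  Orbits = record
    { Carrier       = Antichain
    ; _≈_           = λ A B → ∃[ k ] ρ^ k A ≡ B
    ; isEquivalence = record
      { refl  = + 0 , refl
      ; sym   = λ { {A} (k , refl) → ℤ.- k ,
                  trans (sym (ρ^-+ (ℤ.- k) k A)) (cong (λ i → ρ^ i A) (ℤ.+-inverseˡ k)) }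
      ; trans = λ { {A} (j , refl) (k , refl) → k ℤ.+ j , ρ^-+ k j A }
      }
    }

-- psum α i = α₁ + ⋯ + αᵢ for 0 ≤ i ≤ s.
psum : ∀ {s} → (Fin s → ℕ) → Fin (suc s) → ℕ
psum         α zero    = 0
psum {suc s} α (suc i) = α zero + psum (α ∘ suc) i

-- α has s = suc r parts. A Row indexes a part of α, the corresponding segment and
-- row of the strip; since Fin starts at zero, i : Row is number toℕ i + 1 in the
-- customary numbering 1, …, s, and that number decides Odd and Even.
module Fence {r} (α : Fin (suc r) → ℕ) where

  Row : Set
  Row = Fin (suc r)

  Odd Even : Pred Row 0ℓ
  Odd  i = parity (suc (toℕ i)) ≡ 1ℙ
  Even i = parity (suc (toℕ i)) ≡ 0ℙ

  before after : Row → ℕ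
  before i = psum α (inject₁ i)
  after  i = psum α (suc i)

  n : ℕ
  n = psum α (fromℕ (suc r)) ∸ 1

  -- x : Fin n stands for the element x_k with k = idx x, 1 ≤ k ≤ n.
  idx : Fin n → ℕ
  idx x = suc (toℕ x)

  infix 4 _⋖_ _⊑_
  data _⋖_ (x y : Fin n) : Set where
    up   : ∀ i → Odd i → before i ≤ idx x → idx x < after i →
           idx y ≡ suc (idx x) → x ⋖ y
    down : ∀ i → Even i → before i ≤ idx y → idx y < after i →
           idx x ≡ suc (idx y) → x ⋖ y

  _⊑_ : Rel (Fin n) 0ℓ
  _⊑_ = Star _⋖_

  Segment : Row → Pred (Fin n) 0ℓ
  Segment i x = before i ≤ idx x × idx x ≤ after i

  Shared : Pred (Fin n) 0ℓ
  Shared x = ∃[ i ] ∃[ j ] i ≢ j × Segment i x × Segment j x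

  Unshared : Row → Pred (Fin n) 0ℓ
  Unshared i x = Segment i x × ¬ Shared x

  -- x is the j-th smallest element of P, counted from j = 1.
  data JthSmallest (P : Pred (Fin n) 0ℓ) : ℕ → Fin n → Set where
    first : ∀ {x} → P x → (∀ y → P y → x ⊑ y) → JthSmallest P 1 x
    next  : ∀ {j x y} → JthSmallest P j x → P y → x ⊑ y → x ≢ y →
            (∀ z → P z → x ⊑ z → x ≢ z → y ⊑ z) → JthSmallest P (suc j) y

  Step : Pred Row 0ℓ → Pred ℕ 0ℓ
  Step P k = ∃[ i ] P i × before i ≤ k × k < after i

  step? : ∀ {P} → Decidable₁ P → Decidable₁ (Step P)
  step? P? k = any? λ i → P? i ×-dec (before i ≤? k ×-dec k <? after i)

  psum-unique : ∀ {s} (β : Fin s → ℕ) {k} i j →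
                psum β (inject₁ i) ≤ k → k < psum β (suc i) →
                psum β (inject₁ j) ≤ k → k < psum β (suc j) → i ≡ j
  psum-unique β zero    zero    _ _ _ _ = refl
  psum-unique β zero    (suc j) _ b c _ =
    contradiction (≤-trans (m≤m+n (β zero) _) c)
      (<⇒≱ (subst (_ <_) (+-identityʳ (β zero)) b))
  psum-unique β (suc i) zero    a _ _ d =
    contradiction (≤-trans (m≤m+n (β zero) _) a)
      (<⇒≱ (subst (_ <_) (+-identityʳ (β zero)) d))
  psum-unique β {k} (suc i) (suc j) a b c d =
    cong suc (psum-unique (β ∘ suc) {k ∸ β zero} i j (lo a) (hi b) (lo c) (hi d))
    where
    le : β zero ≤ k
    le = ≤-trans (m≤m+n (β zero) _) a
    eq : k ≡ β zero + (k ∸ β zero)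
    eq = sym (m+[n∸m]≡n le)
    lo : ∀ {m} → β zero + m ≤ k → m ≤ k ∸ β zero
    lo p = +-cancelˡ-≤ (β zero) _ _ (subst (_ ≤_) eq p)
    hi : ∀ {m} → k < β zero + m → k ∸ β zero < m
    hi p = +-cancelˡ-< (β zero) _ _ (subst (_< _) eq p)

  disjoint : ∀ {k} → Step Odd k → ¬ Step Even k
  disjoint (i , o , a , b) (j , e , c , d) with psum-unique α i j a b c d
  ... | refl with trans (sym o) e
  ...   | ()

  Along : Pred Row 0ℓ → ℕ → ℕ → Set
  Along P a b = a ≤ b × (∀ {m} → m < b → a ≤ m → Step P m)

  along? : ∀ {P} → Decidable₁ P → ∀ a b → Dec (Along P a b)
  along? P? a b = a ≤? b ×-dec allUpTo? (λ m → a ≤? m →-dec step? P? m) b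

  Direct : Rel (Fin n) 0ℓ
  Direct x y = Along Odd (idx x) (idx y) ⊎ Along Even (idx y) (idx x)

  clash : ∀ {a b} → Along Odd a b → Along Even a b → a ≡ b
  clash {a} {b} (a≤b , o) (_ , e) with m≤n⇒m<n∨m≡n a≤b
  ... | inj₁ a<b = contradiction (e a<b ≤-refl) (disjoint (o a<b ≤-refl))
  ... | inj₂ eq  = eq

  extend : ∀ {P a b} → Step P a → Along P (suc a) b → Along P a b
  extend {P} {a} s (le , f) = <⇒≤ le , λ {m} m<b a≤m → case m≤n⇒m<n∨m≡n a≤m of λ
    { (inj₁ a<m)  → f m<b a<m
    ; (inj₂ refl) → s }

  extendʳ : ∀ {P a b} → Step P b → Along P a b → Along P a (suc b)
  extendʳ {P} {a} {b} s (le , f) = m≤n⇒m≤1+n le , λ {m} m<sb a≤m →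
    case m≤n⇒m<n∨m≡n (≤-pred m<sb) of λ
    { (inj₁ m<b)  → f m<b a≤m
    ; (inj₂ refl) → s }

  stay : ∀ {P a} → Along P a a
  stay = ≤-refl , λ m<a a≤m → contradiction a≤m (<⇒≱ m<a)

  idx-injective : ∀ {x y} → idx x ≡ idx y → x ≡ y
  idx-injective = toℕ-injective ∘ suc-injective

  ⋖-direct : ∀ {x y z} → x ⋖ y → Direct y z → Direct x z
  ⋖-direct {x} {y} {z} (up i o a b eq) (inj₁ al) =
    inj₁ (extend (i , o , a , b) (subst (λ k → Along Odd k (idx z)) eq al))
  ⋖-direct {x} {y} {z} (up i o a b eq) (inj₂ (le , f)) with m≤n⇒m<n∨m≡n le
  ... | inj₂ z≡y = inj₁ (subst (Along Odd (idx x)) (trans (sym eq) (sym z≡y))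
                     (extendʳ (i , o , a , b) stay))
  ... | inj₁ z<y = contradiction (f (≤-reflexive (sym eq)) (≤-pred (subst (idx z <_) eq z<y)))
                     (disjoint (i , o , a , b))
  ⋖-direct {x} {y} {z} (down i e a b eq) (inj₂ al) =
    inj₂ (subst (Along Even (idx z)) (sym eq) (extendʳ (i , e , a , b) al))
  ⋖-direct {x} {y} {z} (down i e a b eq) (inj₁ (le , f)) with m≤n⇒m<n∨m≡n le
  ... | inj₂ y≡z = inj₂ (subst₂ (Along Even) y≡z (sym eq) (extendʳ (i , e , a , b) stay))
  ... | inj₁ y<z = contradiction (i , e , a , b) (disjoint (f y<z ≤-refl))

  ⊑⇒direct : ∀ {x y} → x ⊑ y → Direct x y
  ⊑⇒direct ε        = inj₁ stay
  ⊑⇒direct (s ◅ ss) = ⋖-direct s (⊑⇒direct ss)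

  climb : ∀ d {x y} → idx y ≡ d + idx x → (∀ {m} → m < idx y → idx x ≤ m → Step Odd m) → x ⊑ y
  climb zero    eq f with idx-injective eq
  ... | refl = ε
  climb (suc d) {x} {y} eq f with f {idx x} x<y ≤-refl
    where x<y = subst (idx x <_) (sym eq) (s≤s (m≤n+m (idx x) d))
  ... | i , o , a , b = up i o a b eq′ ◅ climb d (trans eq (trans (sym (+-suc d (idx x))) (cong (λ m → d + m) (sym eq′))))
                          (λ {m} m<y z≤m → f m<y (≤-trans (n≤1+n _) (subst (_≤ m) eq′ z≤m)))
    where
    z<n : suc (toℕ x) < n
    z<n = ≤-trans (subst (suc (idx x) ≤_) (sym eq) (s≤s (m≤n+m (idx x) d))) (toℕ<n y)
    eq′ : idx (fromℕ< z<n) ≡ suc (idx x)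
    eq′ = cong suc (toℕ-fromℕ< z<n)

  descend : ∀ d {x y} → idx x ≡ d + idx y → (∀ {m} → m < idx x → idx y ≤ m → Step Even m) → x ⊑ y
  descend zero    eq f with idx-injective eq
  ... | refl = ε
  descend (suc d) {x} {y} eq f with f {idx y} y<x ≤-refl
    where y<x = subst (idx y <_) (sym eq) (s≤s (m≤n+m (idx y) d))
  ... | i , e , a , b = descend d (trans eq (trans (sym (+-suc d (idx y))) (cong (λ m → d + m) (sym eq′))))
                          (λ {m} m<x z≤m → f m<x (≤-trans (n≤1+n _) (subst (_≤ m) eq′ z≤m)))
                        ◅◅ (down i e a b eq′ ◅ ε)
    where
    z<n : suc (toℕ y) < n
    z<n = ≤-trans (subst (suc (idx y) ≤_) (sym eq) (s≤s (m≤n+m (idx y) d))) (toℕ<n x)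
    eq′ : idx (fromℕ< z<n) ≡ suc (idx y)
    eq′ = cong suc (toℕ-fromℕ< z<n)

  direct⇒⊑ : ∀ {x y} → Direct x y → x ⊑ y
  direct⇒⊑ (inj₁ (le , f)) = climb   _ (sym (m∸n+n≡m le)) f
  direct⇒⊑ (inj₂ (le , f)) = descend _ (sym (m∸n+n≡m le)) f

  ⊑? : Decidable _⊑_
  ⊑? x y = map′ direct⇒⊑ ⊑⇒direct
    (along? (λ i → parity (suc (toℕ i)) ≟ℙ 1ℙ) (idx x) (idx y) ⊎-dec
     along? (λ i → parity (suc (toℕ i)) ≟ℙ 0ℙ) (idx y) (idx x))

  ⊑-antisym : ∀ {x y} → x ⊑ y → y ⊑ x → x ≡ y
  ⊑-antisym p q with ⊑⇒direct p | ⊑⇒direct q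
  ... | inj₁ (x≤y , _) | inj₁ (y≤x , _) = idx-injective (≤-antisym x≤y y≤x)
  ... | inj₂ (y≤x , _) | inj₂ (x≤y , _) = idx-injective (≤-antisym x≤y y≤x)
  ... | inj₁ o         | inj₂ e         = idx-injective (clash o e)
  ... | inj₂ e         | inj₁ o         = sym (idx-injective (clash o e))

  ⊑-isDecPartialOrder : IsDecPartialOrder _≡_ _⊑_
  ⊑-isDecPartialOrder = record
    { isPartialOrder = record
      { isPreorder = record
        { isEquivalence = isEquivalence
        ; reflexive     = λ { refl → ε }
        ; trans         = _◅◅_
        }
      ; antisym = ⊑-antisym
      }
    ; _≟_  = _≟ᶠ_
    ; _≤?_ = ⊑?
    }

  open Rowmotion ⊑-isDecPartialOrder public

module Tilings {r} (α : Fin (suc r) → ℕ) where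

  open Fence α using (Row; Odd; Even)

  -- A tile of the strip with its colour and position: `yellow i k` is the square
  -- in row i and column k, `red i k` covers rows inject₁ i and suc i of column k,
  -- and `black i _ k` covers the αᵢ - 1 squares of row i starting at column k.
  -- The side condition of black rules out empty tiles.
  data Tile : Set where
    yellow : Row → ℤ → Tile
    red    : Fin r → ℤ → Tile
    black  : (i : Row) → .(1 < α i) → ℤ → Tile

  Covers : Tile → Row → ℤ → Set
  Covers (yellow i k)  i′ k′ = i′ ≡ i × k′ ≡ k
  Covers (red i k)     i′ k′ = (i′ ≡ inject₁ i ⊎ i′ ≡ suc i) × k′ ≡ k
  Covers (black i _ k) i′ k′ = i′ ≡ i × k ℤ.≤ k′ × k′ ℤ.< k ℤ.+ + (α i ∸ 1)

  -- Every square of the strip is covered by exactly one tile of T.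
  Exact : Pred Tile 0ℓ → Set
  Exact T = ∀ i k → ∃! _≡_ λ t → t ∈ᵖ T × Covers t i k

  AllRed : Pred Tile 0ℓ → Row → ℤ → ℤ → Set
  AllRed T i a b = ∀ k → a ℤ.≤ k → k ℤ.< b → ∃[ j ] red j k ∈ᵖ T × Covers (red j k) i k

  -- The black and yellow tiles of row i alternate once the red ones are ignored:
  -- between two tiles of the same colour there is always a square that is not red.
  Alternates : Pred Tile 0ℓ → Row → Set
  Alternates T i =
    (∀ {k l} → k ℤ.< l → yellow i k ∈ᵖ T → yellow i l ∈ᵖ T →
      ¬ AllRed T i (k ℤ.+ + 1) l) ×
    (∀ .(w : 1 < α i) {k l} → k ℤ.< l → black i w k ∈ᵖ T → black i w l ∈ᵖ T →
      ¬ AllRed T i (k ℤ.+ + (α i ∸ 1)) l)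

  TwoYellow : Pred Tile 0ℓ → Fin r → ℤ → Set
  TwoYellow T i k = yellow (inject₁ i) k ∈ᵖ T × yellow (suc i) k ∈ᵖ T

  record IsTiling (T : Pred Tile 0ℓ) : Set where
    field
      exact      : Exact T
      alternates : ∀ i → 1 < α i → Alternates T i
      redRule    : ∀ i k → red i k ∈ᵖ T ⇔
                   (Even (inject₁ i) × TwoYellow T i (k ℤ.- + 1) ⊎
                    Odd  (inject₁ i) × TwoYellow T i (k ℤ.+ + 1))

  translate : ℤ → Tile → Tile
  translate d (yellow i k)  = yellow i (k ℤ.+ d)
  translate d (red i k)     = red i (k ℤ.+ d)
  translate d (black i w k) = black i w (k ℤ.+ d)

  translate-+ : ∀ d e t → translate e (translate d t) ≡ translate (d ℤ.+ e) t
  translate-+ d e (yellow i k)  = cong (yellow i) (ℤ.+-assoc k d e)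
  translate-+ d e (red i k)     = cong (red i) (ℤ.+-assoc k d e)
  translate-+ d e (black i w k) = cong (λ l → black i w l) (ℤ.+-assoc k d e)

  translate-0 : ∀ t → translate (+ 0) t ≡ t
  translate-0 (yellow i k)  = cong (yellow i) (ℤ.+-identityʳ k)
  translate-0 (red i k)     = cong (red i) (ℤ.+-identityʳ k)
  translate-0 (black i w k) = cong (λ l → black i w l) (ℤ.+-identityʳ k)

  infix 4 _∼_
  _∼_ : Rel (Pred Tile 0ℓ) 0ℓ
  T ∼ T′ = ∃[ d ] ∀ t → t ∈ᵖ T ⇔ translate d t ∈ᵖ T′

  ∼-refl : ∀ {T} → T ∼ T
  ∼-refl {T} = + 0 , λ t → mk⇔ (subst T (sym (translate-0 t))) (subst T (translate-0 t))

  ∼-sym : ∀ {T T′} → T ∼ T′ → T′ ∼ T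
  ∼-sym {T} {T′} (d , h) = ℤ.- d , λ t → mk⇔
    (λ t∈ → Equivalence.from (h _) (subst T′ (sym (back t)) t∈))
    (λ t∈ → subst T′ (back t) (Equivalence.to (h _) t∈))
    where
    back : ∀ t → translate d (translate (ℤ.- d) t) ≡ t
    back t = trans (translate-+ (ℤ.- d) d t)
      (trans (cong (λ e → translate e t) (ℤ.+-inverseˡ d)) (translate-0 t))

  ∼-trans : ∀ {T T′ T″} → T ∼ T′ → T′ ∼ T″ → T ∼ T″
  ∼-trans {T″ = T″} (d , h) (e , h′) = d ℤ.+ e , λ t → mk⇔
    (λ t∈ → subst T″ (translate-+ d e t) (Equivalence.to (h′ _) (Equivalence.to (h t) t∈)))
    (λ t∈ → Equivalence.from (h t) (Equivalence.from (h′ _) (subst T″ (sym (translate-+ d e t)) t∈)))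

  AlphaTilings : Setoid (lsuc 0ℓ) 0ℓ
  AlphaTilings = record
    { Carrier       = Σ (Pred Tile 0ℓ) IsTiling
    ; _≈_           = λ T T′ → proj₁ T ∼ proj₁ T′
    ; isEquivalence = record
      { refl  = λ {T} → ∼-refl {proj₁ T}
      ; sym   = λ {T} {T′} → ∼-sym {proj₁ T} {proj₁ T′}
      ; trans = λ {T} {T′} {T″} → ∼-trans {proj₁ T} {proj₁ T′} {proj₁ T″}
      }
    }

module _ {r} (α : Fin (suc r) → ℕ) where

  open Fence α
  open Tilings α

  -- Column k shows ρ^k A, and square j of a black tile (from j = 0) shows the
  -- (j+1)-st smallest unshared element of its segment.
  φ : Antichain → Pred Tile 0ℓ
  φ A (yellow i k)  = ¬ (∃[ x ] Segment i x × x ∈ elements (ρ^ k A))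
  φ A (red i k)     = ∃[ x ] Segment (inject₁ i) x × Segment (suc i) x × x ∈ elements (ρ^ k A)
  φ A (black i _ k) = (j : Fin (α i ∸ 1)) →
    ∃[ x ] JthSmallest (Unshared i) (suc (toℕ j)) x × x ∈ elements (ρ^ (k ℤ.+ + toℕ j) A)

{-# OPTIONS --safe #-}
module Submission where

-- Rowmotion is governed by rules that are local in time and in the segments
-- (`Next`): along a segment an antichain element climbs one unshared element at
-- a time, a shared minimal element enters exactly when both of its segments were
-- empty, and a shared maximal element is exactly what forces both of its segments
-- to be empty next. These rules determine the next antichain, so a ℤ-indexed
-- sequence of antichains is a rowmotion orbit iff it obeys them. Drawing such a
-- sequence column by column (`Shows`, `IsPicture`), the rules for the shared
-- elements become the red rule, and those for the unshared elements become the
-- grouping into black tiles and the alternation of colours. The columns of a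
-- tiling can be read off because exactness makes membership of a tile decidable.

open import Defs
open import Data.Fin using (Fin; zero; suc; toℕ; fromℕ; fromℕ<; inject₁)
open import Data.Fin.Properties using (any?; toℕ-injective; toℕ<n; toℕ-fromℕ<; toℕ-inject₁; ≤fromℕ;
  inject₁-injective; suc-injective) renaming (_≟_ to _≟ᶠ_)
open import Data.Fin.Relation.Unary.Top using (view; ‵fromℕ; ‵inject₁)
open import Data.Fin.Subset using (Subset; _∈_; _∉_)
open import Data.Fin.Subset.Properties using (_∈?_; ⊆-antisym)
open import Data.Integer as ℤ using (ℤ; +_; -[1+_])
import Data.Integer.Properties as ℤ
open import Data.Nat using (ℕ; zero; suc; _+_; _∸_; _≤_; _<_; z≤n; s≤s; parity)
open import Data.Nat.Properties hiding (suc-injective)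
open import Data.Parity.Base using (0ℙ; 1ℙ; _⁻¹)
open import Data.Parity.Properties using (suc-homo-⁻¹)
open import Data.Product using (Σ; ∃-syntax; _×_; _,_; proj₁; proj₂; map₂)
open import Data.Sum using (_⊎_; inj₁; inj₂; [_,_]′)
open import Function using (_∘_; _⇔_; mk⇔; Equivalence)
open import Function.Structures using (IsBijection)
open import Level using (0ℓ)
open import Relation.Binary using (Setoid; DecidableEquality)
open import Relation.Binary.Construct.Closure.ReflexiveTransitive using (ε; _◅_; _◅◅_)
open import Relation.Binary.Definitions using (tri<; tri≈; tri>)
open import Relation.Binary.PropositionalEquality
open import Relation.Nullary using (¬_; Dec; recompute; yes; no; contradiction)
open import Relation.Nullary.Decidable using (_×-dec_; _⊎-dec_; map′; decidable-stable)
open import Relation.Unary using (Pred) renaming (Decidable to Decidable₁)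

-- Partial sums of a composition

psum-suc : ∀ {s} (β : Fin s → ℕ) i → psum β (suc i) ≡ psum β (inject₁ i) + β i
psum-suc β zero    = +-identityʳ (β zero)
psum-suc β (suc i) = trans (cong (_+_ (β zero)) (psum-suc (β ∘ suc) i)) (sym (+-assoc (β zero) _ _))

psum-mono : ∀ {s} (β : Fin s → ℕ) {i j : Fin (suc s)} → toℕ i ≤ toℕ j → psum β i ≤ psum β j
psum-mono β {zero}              _       = z≤n
psum-mono {suc s} β {suc i} {suc j} (s≤s le) = +-monoʳ-≤ (β zero) (psum-mono (β ∘ suc) le)

psum-locate : ∀ {s} (β : Fin s → ℕ) {k} → k < psum β (fromℕ s) →
              ∃[ i ] psum β (inject₁ i) ≤ k × k < psum β (suc i)
psum-locate {suc s} β {k} k< with k <? β zero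
... | yes k<β = zero , z≤n , ≤-trans k<β (m≤m+n (β zero) 0)
... | no k≮β with psum-locate (β ∘ suc) {k ∸ β zero}
                    (+-cancelˡ-< (β zero) _ _ (subst (_< _) (sym (m+[n∸m]≡n (≮⇒≥ k≮β))) k<))
...   | i , lo , hi = suc i
    , subst (_ ≤_) (m+[n∸m]≡n (≮⇒≥ k≮β)) (+-monoʳ-≤ (β zero) lo)
    , subst (_< _) (m+[n∸m]≡n (≮⇒≥ k≮β)) (+-monoʳ-< (β zero) hi)

inject₁≢suc : ∀ {s} (j : Fin s) → inject₁ j ≢ suc j
inject₁≢suc j eq = <⇒≢ (n<1+n (toℕ j)) (trans (sym (toℕ-inject₁ j)) (cong toℕ eq))

-- The fence in coordinates: joints between segments, heights along a segment

module FenceProperties {r} (α : Fin (suc r) → ℕ) (α-pos : ∀ i → 1 ≤ α i) where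

  open Fence α

  after≡before+α : ∀ i → after i ≡ before i + α i
  after≡before+α = psum-suc α

  before<after : ∀ i → before i < after i
  before<after i = subst₂ _≤_ (+-comm (before i) 1) (sym (after≡before+α i)) (+-monoʳ-≤ (before i) (α-pos i))

  total : ℕ
  total = psum α (fromℕ (suc r))

  after≤total : ∀ i → after i ≤ total
  after≤total i = psum-mono α {suc i} {fromℕ (suc r)} (≤fromℕ (suc i))

  idx<total : ∀ x → idx x < total
  idx<total x = ≤-trans (s≤s (toℕ<n x))
    (≤-reflexive (m+[n∸m]≡n (≤-trans (s≤s z≤n) (≤-trans (before<after zero) (after≤total zero)))))

  element : ∀ {k} → 0 < k → k < total → ∃[ x ] idx x ≡ k
  element {suc k} _ k< = fromℕ< k<n , cong suc (toℕ-fromℕ< k<n)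
    where k<n = ≤-pred (≤-trans k< (m≤n+m∸n total 1))

  odd⊎even : ∀ i → Odd i ⊎ Even i
  odd⊎even i with parity (suc (toℕ i))
  ... | 1ℙ = inj₁ refl
  ... | 0ℙ = inj₂ refl

  odd∧even : ∀ i → Odd i → ¬ Even i
  odd∧even i o e with trans (sym o) e
  ... | ()

  parity-next : ∀ (j : Fin r) → parity (suc (toℕ (inject₁ j))) ≡ parity (suc (toℕ (suc j))) ⁻¹
  parity-next j rewrite toℕ-inject₁ j = sym (suc-homo-⁻¹ (suc (toℕ j)))

  odd-next : ∀ {j} → Odd (inject₁ j) → Even (suc j)
  odd-next {j} o with parity (toℕ j) | trans (sym (parity-next j)) o
  ... | 0ℙ | _ = refl
  ... | 1ℙ | ()

  even-next : ∀ {j} → Even (inject₁ j) → Odd (suc j)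
  even-next {j} e with parity (toℕ j) | trans (sym (parity-next j)) e
  ... | 1ℙ | _ = refl
  ... | 0ℙ | ()

  segment? : ∀ i x → Dec (Segment i x)
  segment? i x = before i ≤? idx x ×-dec idx x ≤? after i

  On : Fin r → Row → Set
  On j i = i ≡ inject₁ j ⊎ i ≡ suc j

  -- A record rather than the bare equation, so that `j` can be recovered by unification from a
  -- proof.
  record Joint (j : Fin r) (x : Fin n) : Set where
    constructor joint
    field joint-idx : idx x ≡ after (inject₁ j)

  joint-segment : ∀ {j x i} → Joint j x → On j i → Segment i x
  joint-segment {j} (joint p) (inj₁ refl) =
    subst (before (inject₁ j) ≤_) (sym p) (<⇒≤ (before<after (inject₁ j))) , ≤-reflexive p
  joint-segment {j} (joint p) (inj₂ refl) =
    ≤-reflexive (sym p) , subst (_≤ after (suc j)) (sym p) (<⇒≤ (before<after (suc j)))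

  segments-joint : ∀ {j x} → Segment (inject₁ j) x → Segment (suc j) x → Joint j x
  segments-joint (_ , le) (ge , _) = joint (≤-antisym le ge)

  joint-exists : ∀ j → ∃[ x ] Joint j x
  joint-exists j = map₂ joint (element (≤-trans (s≤s z≤n) (before<after (inject₁ j)))
    (≤-trans (before<after (suc j)) (after≤total (suc j))))

  joint-unique : ∀ {j x y} → Joint j x → Joint j y → x ≡ y
  joint-unique (joint p) (joint q) = idx-injective (trans p (sym q))

  -- If row `j` did not directly follow row `i`, a whole segment of positive length would separate
  -- `after i` from `before j`, and no index could reach both. The common index is then the boundary
  -- itself.
  adjacent : ∀ {i j x} → toℕ i < toℕ j → Segment i x → Segment j x →
             ∃[ m ] i ≡ inject₁ m × j ≡ suc m × Joint m x
  adjacent {i} {suc m} (s≤s i≤m) (_ , x≤) (≤x , _)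
    with m≤n⇒m<n∨m≡n (subst (toℕ i ≤_) (sym (toℕ-inject₁ m)) i≤m)
  ... | inj₁ i<m = contradiction
        (≤-trans ≤x (≤-trans x≤ (psum-mono α {suc i} {inject₁ (inject₁ m)}
          (subst (suc (toℕ i) ≤_) (sym (toℕ-inject₁ (inject₁ m))) i<m))))
        (<⇒≱ (before<after (inject₁ m)))
  ... | inj₂ i≡m with toℕ-injective i≡m
  ...   | refl = m , refl , refl , joint (≤-antisym x≤ ≤x)

  joint-on : ∀ {j x i} → Joint j x → Segment i x → On j i
  joint-on {j} {x} {i} p s with <-cmp (toℕ i) (toℕ (suc j))
  ... | tri≈ _ eq _ = inj₂ (toℕ-injective eq)
  ... | tri< lt _ _ with adjacent lt s (joint-segment p (inj₂ refl))
  ...   | _ , refl , refl , _ = inj₁ refl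
  joint-on {j} {x} {i} p s | tri> _ _ gt
    with adjacent {inject₁ j} {i} (≤-trans (s≤s (≤-trans (≤-reflexive (toℕ-inject₁ j)) (n≤1+n _))) gt)
           (joint-segment p (inj₁ refl)) s
  ... | m , e , refl , _ = inj₂ (cong suc (sym (inject₁-injective e)))

  two-segments : ∀ {i j x} → i ≢ j → Segment i x → Segment j x → ∃[ m ] Joint m x
  two-segments {i} {j} i≢j s t with <-cmp (toℕ i) (toℕ j)
  ... | tri< lt _ _ = let m , _ , _ , p = adjacent lt s t in m , p
  ... | tri≈ _ eq _ = contradiction (toℕ-injective eq) i≢j
  ... | tri> _ _ gt = let m , _ , _ , p = adjacent gt t s in m , p

  joint-injective : ∀ {j j′ x} → Joint j x → Joint j′ x → j ≡ j′
  joint-injective {j} {j′} p q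
    with joint-on p (joint-segment q (inj₁ refl)) | joint-on p (joint-segment q (inj₂ refl))
  ... | inj₁ e | _      = sym (inject₁-injective e)
  ... | _      | inj₂ e = sym (suc-injective e)
  ... | inj₂ e | inj₁ e′ = contradiction
    (trans (cong suc (trans (sym (cong toℕ e)) (toℕ-inject₁ j′))) (trans (cong toℕ e′) (toℕ-inject₁ j)))
    (m+1+n≢n 1)

  -- Heights run from 0 to α i; the unshared elements of a segment have heights
  -- strictly between, and 0 and α i are missing at the free ends of the fence.
  data At (i : Row) (h : ℕ) (x : Fin n) : Set where
    rising  : Odd i  → h ≤ α i → idx x ≡ before i + h → At i h x
    falling : Even i → h ≤ α i → idx x + h ≡ after i → At i h x

  at-≤ : ∀ {i h x} → At i h x → h ≤ α i
  at-≤ (rising  _ le _) = le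
  at-≤ (falling _ le _) = le

  at-unique : ∀ {i h x y} → At i h x → At i h y → x ≡ y
  at-unique (rising  _ _ e) (rising  _ _ f) = idx-injective (trans e (sym f))
  at-unique (falling _ _ e) (falling _ _ f) = idx-injective (+-cancelʳ-≡ _ _ _ (trans e (sym f)))
  at-unique {i} (rising  o _ _) (falling e _ _) = contradiction e (odd∧even i o)
  at-unique {i} (falling e _ _) (rising  o _ _) = contradiction e (odd∧even i o)

  height-unique : ∀ {i h h′ x} → At i h x → At i h′ x → h ≡ h′
  height-unique {i} (rising  _ _ e) (rising  _ _ f) = +-cancelˡ-≡ (before i) _ _ (trans (sym e) f)
  height-unique {x = x} (falling _ _ e) (falling _ _ f) = +-cancelˡ-≡ (idx x) _ _ (trans e (sym f))
  height-unique {i} (rising  o _ _) (falling e _ _) = contradiction e (odd∧even i o)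
  height-unique {i} (falling e _ _) (rising  o _ _) = contradiction e (odd∧even i o)

  at-segment : ∀ {i h x} → At i h x → Segment i x
  at-segment {i} {h} (rising _ le e) = subst (before i ≤_) (sym e) (m≤m+n _ h)
    , subst₂ _≤_ (sym e) (sym (after≡before+α i)) (+-monoʳ-≤ (before i) le)
  at-segment {i} {h} {x} (falling _ le e) =
      +-cancelʳ-≤ h _ _ (subst
        (before i + h ≤_) (trans (sym (after≡before+α i)) (sym e)) (+-monoʳ-≤ (before i) le))
    , subst (idx x ≤_) e (m≤m+n _ h)

  segment-at : ∀ {i x} → Segment i x → ∃[ h ] At i h x
  segment-at {i} {x} (lo , hi) with odd⊎even i
  ... | inj₁ o = idx x ∸ before i , rising o
        (+-cancelˡ-≤ (before i) _ _ (subst₂ _≤_ (sym (m+[n∸m]≡n lo)) (after≡before+α i) hi))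
        (sym (m+[n∸m]≡n lo))
  ... | inj₂ e = after i ∸ idx x , falling e
        (+-cancelˡ-≤ (idx x) _ _ (subst₂ _≤_ (sym (m+[n∸m]≡n hi)) refl
          (≤-trans (≤-reflexive (after≡before+α i)) (+-monoˡ-≤ (α i) lo))))
        (m+[n∸m]≡n hi)

  at? : ∀ i h x → Dec (At i h x)
  at? i h x with segment? i x
  ... | no ¬s = no (¬s ∘ at-segment)
  ... | yes s with segment-at s
  ...   | h′ , a = map′ (λ { refl → a }) (λ b → height-unique a b) (h′ ≟ h)

  at-exists : ∀ {i h} → 0 < h → h < α i → ∃[ x ] At i h x
  at-exists {i} {h} 0<h h<α with odd⊎even i
  ... | inj₁ o = let x , e = element (≤-trans 0<h (m≤n+m h (before i)))
                               (≤-trans (≤-trans (+-monoʳ-< (before i) h<α) (≤-reflexive (sym (after≡before+α i))))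
                                 (after≤total i))
                 in x , rising o (<⇒≤ h<α) e
  ... | inj₂ e = let x , f = element {after i ∸ h} (m<n⇒0<n∸m h<after)
                               (≤-trans (∸-monoʳ-< 0<h (<⇒≤ h<after)) (after≤total i))
                 in x , falling e (<⇒≤ h<α) (trans (cong (_+ h) f) (m∸n+n≡m (<⇒≤ h<after)))
    where
    h<after : h < after i
    h<after = ≤-trans h<α (≤-trans (m≤n+m (α i) (before i)) (≤-reflexive (sym (after≡before+α i))))

  -- Height 0 is the left end of a rising row or the right end of a falling one, so the joint there
  -- is a valley with an even row on its left. The free ends of the fence are excluded because
  -- indices lie strictly between 0 and `total`.
  bottom-joint : ∀ {i x} → At i 0 x → ∃[ j ] Joint j x × Even (inject₁ j) × On j i
  bottom-joint {zero} {x} (rising _ _ ())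
  bottom-joint {suc j} {x} (rising o _ eq) with odd⊎even (inject₁ j)
  ... | inj₁ o′ = contradiction (odd-next {j} o′) (odd∧even (suc j) o)
  ... | inj₂ e  = j , joint (trans eq (+-identityʳ _)) , e , inj₂ refl
  bottom-joint {i} {x} (falling e _ eq) with view i
  ... | ‵fromℕ    = contradiction (trans (sym (+-identityʳ _)) eq) (<⇒≢ (idx<total x))
  ... | ‵inject₁ j = j , joint (trans (sym (+-identityʳ _)) eq) , e , inj₁ refl

  top-joint : ∀ {i x} → At i (α i) x → ∃[ j ] Joint j x × Odd (inject₁ j) × On j i
  top-joint {zero} {x} (falling () _ _)
  top-joint {suc j} {x} (falling e _ eq) with odd⊎even (inject₁ j)
  ... | inj₂ e′ = contradiction e (odd∧even (suc j) (even-next {j} e′))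
  ... | inj₁ o  = j , joint (+-cancelʳ-≡ (α (suc j)) _ _ (trans eq (after≡before+α (suc j)))) , o , inj₂ refl
  top-joint {i} {x} (rising o _ eq) with view i
  ... | ‵fromℕ    = contradiction (trans eq (sym (after≡before+α i))) (<⇒≢ (idx<total x))
  ... | ‵inject₁ j = j , joint (trans eq (sym (after≡before+α i))) , o , inj₁ refl

  joint-bottom : ∀ {j x i} → Joint j x → Even (inject₁ j) → On j i → At i 0 x
  joint-bottom (joint p) e (inj₁ refl) = falling e z≤n (trans (+-identityʳ _) p)
  joint-bottom {j} (joint p) e (inj₂ refl) = rising (even-next {j} e) z≤n (trans p (sym (+-identityʳ _)))

  joint-top : ∀ {j x i} → Joint j x → Odd (inject₁ j) → On j i → At i (α i) x
  joint-top {i = i} (joint p) o (inj₁ refl) = rising o ≤-refl (trans p (after≡before+α i))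
  joint-top {j} {i = i} (joint p) o (inj₂ refl) =
    falling (odd-next {j} o) ≤-refl (trans (cong (_+ α i) p) (sym (after≡before+α i)))

  -- Two rows meet only in a joint, and a joint is a valley for both of its rows or a peak for both.
  other-row : ∀ {i i′ h h′ x} → i ≢ i′ → At i h x → At i′ h′ x →
              (h ≡ 0 × h′ ≡ 0) ⊎ (h ≡ α i × h′ ≡ α i′)
  other-row {i} {i′} i≢i′ a a′ with two-segments {i} {i′} i≢i′ (at-segment a) (at-segment a′)
  ... | j , p with odd⊎even (inject₁ j) | joint-on {i = i} p (at-segment a) | joint-on {i = i′} p (at-segment a′)
  ...   | inj₁ o | on | on′ = inj₂ (height-unique a (joint-top p o on)
                                             , height-unique a′ (joint-top p o on′))
  ...   | inj₂ e | on | on′ = inj₁ (height-unique a (joint-bottom p e on)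
                                             , height-unique a′ (joint-bottom p e on′))

  -- The order expressed through heights

  at-⊑ : ∀ {i h h′ x y} → At i h x → At i h′ y → h ≤ h′ → x ⊑ y
  at-⊑ {i} {h} {h′} {x} {y} a@(rising o _ e) b@(rising _ _ f) le = direct⇒⊑ {x} {y} (inj₁
    ( subst₂ _≤_ (sym e) (sym f) (+-monoʳ-≤ (before i) le)
    , λ m< ≤m → i , o , ≤-trans (proj₁ (at-segment a)) ≤m , ≤-trans m< (proj₂ (at-segment b))))
  at-⊑ {i} {h} {h′} {x} {y} a@(falling ev le₁ e) b@(falling _ le₂ f) le = direct⇒⊑ {x} {y} (inj₂
    ( +-cancelʳ-≤ h _ _ (≤-trans (+-monoʳ-≤ (idx y) le) (≤-reflexive (trans f (sym e))))
    , λ m< ≤m → i , ev , ≤-trans (proj₁ (at-segment b)) ≤m , ≤-trans m< (proj₂ (at-segment a))))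
  at-⊑ {i} (rising o _ _) (falling e _ _) _ = contradiction e (odd∧even i o)
  at-⊑ {i} (falling e _ _) (rising o _ _) _ = contradiction e (odd∧even i o)

  ⋖-at : ∀ {x y} → x ⋖ y → ∃[ i ] ∃[ h ] At i h x × At i (suc h) y
  ⋖-at {x} {y} (up i o lo hi eq) with segment-at {i} {x} (lo , <⇒≤ hi)
  ... | h , falling e _ _ = contradiction e (odd∧even i o)
  ... | h , a@(rising _ _ f) = i , h , a , rising o h<α (trans eq (trans (cong suc f) (sym (+-suc _ h))))
    where h<α = +-cancelˡ-< (before i) _ _ (subst₂ _<_ f (after≡before+α i) hi)
  ⋖-at {x} {y} (down i e lo hi eq)
    with segment-at {i} {x} (≤-trans lo (≤-trans (n≤1+n _) (≤-reflexive (sym eq)))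
                            , subst (_≤ after i) (sym eq) hi)
  ... | h , rising o _ _ = contradiction e (odd∧even i o)
  ... | h , a@(falling _ _ f) = i , h , a , falling e h<α eq′
    where
    eq′ : idx y + suc h ≡ after i
    eq′ = trans (+-suc (idx y) h) (trans (cong (_+ h) (sym eq)) f)
    h<α = +-cancelˡ-≤ (idx y) _ _ (subst₂ _≤_ (sym eq′) refl
            (≤-trans (≤-reflexive (after≡before+α i)) (+-monoˡ-≤ (α i) lo)))

  row-of : ∀ x → ∃[ i ] ∃[ h ] At i h x
  row-of x with psum-locate α (idx<total x)
  ... | i , lo , hi = i , segment-at (lo , <⇒≤ hi)

  -- Induction along the chain of covers. The first cover ends at a positive height, so if the rest
  -- of the chain uses another row, the crossing point is a peak; being at the top height of that
  -- row already, the rest of the chain cannot move any further.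
  common-row : ∀ {x y} → x ⊑ y → ∃[ i ] ∃[ h ] ∃[ h′ ] At i h x × At i h′ y × h ≤ h′
  common-row {x} ε = let i , h , a = row-of x in i , h , h , a , a , ≤-refl
  common-row (s ◅ ss) with ⋖-at s | common-row ss
  ... | i , h , a , b | i′ , k , l , c , d , k≤l with i ≟ᶠ i′
  ...   | yes refl = i , h , l , a , d , ≤-trans (n≤1+n h) (≤-trans (≤-reflexive (height-unique b c)) k≤l)
  ...   | no i≢i′ with other-row i≢i′ b c
  ...     | inj₁ (() , _)
  ...     | inj₂ (_ , refl) with at-unique c (subst (λ m → At i′ m _) (≤-antisym (at-≤ d) k≤l) d)
  ...       | refl = i , h , suc h , a , b , n≤1+n h

  at-⊑⁻ : ∀ {i h h′ x y} → At i h x → At i h′ y → x ⊑ y → h ≤ h′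
  at-⊑⁻ {h = h} {h′} a b x⊑y with ≤-total h h′
  ... | inj₁ le = le
  ... | inj₂ ge with ⊑-antisym x⊑y (at-⊑ b a ge)
  ...   | refl = ≤-reflexive (height-unique a b)

  at-⊏⁻ : ∀ {i h h′ x y} → At i h x → At i h′ y → x ⊑ y → x ≢ y → h < h′
  at-⊏⁻ a b x⊑y x≢y = ≤∧≢⇒< (at-⊑⁻ a b x⊑y) λ { refl → x≢y (at-unique a b) }

  -- With `0 < h`, another row can be met only at a peak, where nothing lies strictly above.
  above-at : ∀ {i h x y} → 0 < h → At i h x → x ⊑ y → ∃[ h′ ] At i h′ y × h ≤ h′
  above-at {i} 0<h a x⊑y with common-row x⊑y
  ... | i′ , k , l , c , d , k≤l with i ≟ᶠ i′
  ...   | yes refl = l , d , subst (_≤ l) (height-unique c a) k≤l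
  ...   | no i≢i′ with other-row i≢i′ a c
  ...     | inj₁ (refl , _) = contradiction 0<h λ ()
  ...     | inj₂ (_ , refl) with at-unique c (subst (λ m → At i′ m _) (≤-antisym (at-≤ d) k≤l) d)
  ...       | refl = _ , a , ≤-refl

  -- Dual to `above-at`: short of the top height, another row can be met only at a valley, where
  -- nothing lies strictly below.
  below-at : ∀ {i h x y} → h < α i → At i h y → x ⊑ y → ∃[ h′ ] At i h′ x × h′ ≤ h
  below-at {i} h<α a x⊑y with common-row x⊑y
  ... | i′ , k , l , c , d , k≤l with i ≟ᶠ i′
  ...   | yes refl = k , c , subst (k ≤_) (height-unique d a) k≤l
  ...   | no i≢i′ with other-row i≢i′ a d
  ...     | inj₂ (refl , _) = contradiction h<α (<-irrefl refl)
  ...     | inj₁ (_ , refl) with at-unique d (subst (λ m → At i′ m _) (n≤0⇒n≡0 k≤l) c)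
  ...       | refl = _ , a , ≤-refl

  above-joint : ∀ {j x y} → Joint j x → Even (inject₁ j) → x ⊑ y → Segment (inject₁ j) y ⊎ Segment (suc j) y
  above-joint p e x⊑y with common-row x⊑y
  ... | i , _ , _ , c , d , _ with joint-on {i = i} p (at-segment c)
  ...   | inj₁ refl = inj₁ (at-segment d)
  ...   | inj₂ refl = inj₂ (at-segment d)

  below-joint : ∀ {j x y} → Joint j x → Odd (inject₁ j) → y ⊑ x → Segment (inject₁ j) y ⊎ Segment (suc j) y
  below-joint p o y⊑x with common-row y⊑x
  ... | i , _ , _ , c , d , _ with joint-on {i = i} p (at-segment d)
  ...   | inj₁ refl = inj₁ (at-segment c)
  ...   | inj₂ refl = inj₂ (at-segment c)

  joint-below : ∀ {j x y i} → Joint j x → Even (inject₁ j) → On j i → Segment i y → x ⊑ y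
  joint-below {i = i} p e on s = at-⊑ (joint-bottom p e on) (proj₂ (segment-at {i} s)) z≤n

  joint-above : ∀ {j x y i} → Joint j x → Odd (inject₁ j) → On j i → Segment i y → y ⊑ x
  joint-above {i = i} p o on s = let _ , a = segment-at {i} s in at-⊑ a (joint-top p o on) (at-≤ a)

  joint-minimal : ∀ {j x y} → Joint j x → Even (inject₁ j) → y ⊑ x → y ≡ x
  joint-minimal {j} p e y⊑x with below-at (α-pos _) (joint-bottom p e (inj₁ refl)) y⊑x
  ... | _ , a , z≤n = at-unique a (joint-bottom p e (inj₁ refl))

  joint-maximal : ∀ {j x y} → Joint j x → Odd (inject₁ j) → x ⊑ y → x ≡ y
  joint-maximal {j} p o x⊑y with above-at (α-pos _) (joint-top p o (inj₁ refl)) x⊑y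
  ... | _ , a , le = at-unique (joint-top p o (inj₁ refl))
                       (subst (λ h → At (inject₁ j) h _) (≤-antisym (at-≤ a) le) a)

  -- Interior heights and unshared elements

  Interior : Row → ℕ → Set
  Interior i h = 0 < h × h < α i

  interior-row : ∀ {i i′ h x} → At i h x → Interior i h → Segment i′ x → i ≡ i′
  interior-row {i} {i′} a (0<h , h<α) s with i ≟ᶠ i′
  ... | yes eq = eq
  ... | no i≢i′ with other-row i≢i′ a (proj₂ (segment-at {i′} s))
  ...   | inj₁ (refl , _) = contradiction 0<h λ ()
  ...   | inj₂ (refl , _) = contradiction h<α (<-irrefl refl)

  interior-not-joint : ∀ {i j h x} → At i h x → Interior i h → ¬ Joint j x
  interior-not-joint {j = j} a int p = inject₁≢suc j (trans
    (sym (interior-row {i′ = inject₁ j} a int (joint-segment p (inj₁ refl))))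
    (interior-row {i′ = suc j} a int (joint-segment p (inj₂ refl))))

  joint⊎interior : ∀ {i x} → Segment i x →
                   (∃[ j ] Joint j x × On j i) ⊎ (∃[ h ] At i h x × Interior i h)
  joint⊎interior {i} s with segment-at {i} s
  ... | zero , a = let j , p , _ , on = bottom-joint a in inj₁ (j , p , on)
  ... | suc h , a with m≤n⇒m<n∨m≡n (at-≤ a)
  ...   | inj₁ lt = inj₂ (suc h , a , s≤s z≤n , lt)
  ...   | inj₂ eq = let j , p , _ , on = top-joint (subst (λ m → At i m _) eq a) in inj₁ (j , p , on)

  interior-unshared : ∀ {i h x} → At i h x → Interior i h → Unshared i x
  interior-unshared a int = at-segment a , λ { (k , l , k≢l , s , t) →
    interior-not-joint a int (proj₂ (two-segments {k} {l} k≢l s t)) }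

  unshared-interior : ∀ {i x} → Unshared i x → ∃[ h ] At i h x × Interior i h
  unshared-interior {i} {x} (s , ¬shared) with joint⊎interior {i} s
  ... | inj₂ int = int
  ... | inj₁ (j , p , _) = contradiction
        (inject₁ j , suc j , inject₁≢suc j , joint-segment p (inj₁ refl) , joint-segment p (inj₂ refl)) ¬shared

  -- Interior heights start at 1 and have no gaps, so the rank of an unshared element is its height.
  -- This links the black squares of `φ` to heights.
  at-jth : ∀ {i x} h → At i (suc h) x → suc h < α i → JthSmallest (Unshared i) (suc h) x
  at-jth zero a lt = first (interior-unshared a (s≤s z≤n , lt)) λ y u →
    let _ , b , 0<h , _ = unshared-interior u in at-⊑ a b 0<h
  at-jth {i} {x} (suc h) a lt with at-exists {i} {suc h} (s≤s z≤n) (<-trans (n<1+n _) lt)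
  ... | w , b = next (at-jth h b (<-trans (n<1+n _) lt)) (interior-unshared a (s≤s z≤n , lt))
        (at-⊑ b a (n≤1+n _))
        (λ { refl → <⇒≢ (n<1+n _) (height-unique b a) })
        λ z u w⊑z w≢z → let _ , c , _ = unshared-interior u in
          at-⊑ a c (at-⊏⁻ b c w⊑z w≢z)

  -- Leastness is tested against the element one height above the previous one, which bounds the
  -- height from above; strict increase bounds it from below.
  jth-at : ∀ {i h x} → JthSmallest (Unshared i) h x → At i h x
  jth-at {i} (first u least) with unshared-interior u
  ... | h , a , 0<h , h<α with at-exists {i} {1} (s≤s z≤n) (≤-<-trans 0<h h<α)
  ...   | y , b = subst (λ m → At i m _)
                    (≤-antisym (at-⊑⁻ a b (least y (interior-unshared b (s≤s z≤n , ≤-<-trans 0<h h<α)))) 0<h) a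
  jth-at {i} (next {h} {x} {y} jth u x⊑y x≢y least) with unshared-interior u
  ... | k , a , _ , k<α with jth-at jth
  ...   | b with at-⊏⁻ b a x⊑y x≢y
  ...     | h<k with at-exists {i} {suc h} (s≤s z≤n) (≤-<-trans h<k k<α)
  ...       | z , c = subst (λ m → At i m _) (≤-antisym (at-⊑⁻ a c
                        (least z (interior-unshared c (s≤s z≤n , ≤-<-trans h<k k<α)) (at-⊑ b c (n≤1+n h))
                          λ { refl → <⇒≢ (n<1+n h) (height-unique b c) })) h<k) a

-- Rowmotion as local rules

module LocalRules {r} (α : Fin (suc r) → ℕ) (α-pos : ∀ i → 1 ≤ α i) where

  open Fence α
  open FenceProperties α α-pos

  Avoids : Subset n → Row → Set
  Avoids A i = ¬ (∃[ x ] Segment i x × x ∈ A)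

  avoids-on : ∀ {j i C} → On j i → Avoids C (inject₁ j) × Avoids C (suc j) → Avoids C i
  avoids-on (inj₁ refl) (av , _) = av
  avoids-on (inj₂ refl) (_ , av) = av

  -- The asymmetry follows the red rule: valleys look back in time, peaks look ahead. So `top`
  -- describes `A` through `B`, and `start` mentions the bottom of `B` besides `A`; that `B` is
  -- determined nevertheless is `next-deterministic`.
  record Next (A B : Subset n) : Set where
    field
      grow   : ∀ {i h x y} → 0 < h → suc h < α i → At i h x → At i (suc h) y → x ∈ A ⇔ y ∈ B
      start  : ∀ {i y} → 1 < α i → At i 1 y →
               y ∈ B ⇔ ((∃[ x ] At i 0 x × x ∈ A) ⊎ (Avoids A i × ¬ (∃[ x ] At i 0 x × x ∈ B)))
      bottom : ∀ {j x} → Joint j x → Even (inject₁ j) → x ∈ B ⇔ (Avoids A (inject₁ j) × Avoids A (suc j))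
      top    : ∀ {j x} → Joint j x → Odd (inject₁ j) → x ∈ A ⇔ (Avoids B (inject₁ j) × Avoids B (suc j))

  MinimalOutside : Subset n → Fin n → Set
  MinimalOutside E = Poset.Minimal ⊑-isDecPartialOrder (Poset.OutsideIdeal ⊑-isDecPartialOrder E)

  -- `E′` is a variable known only through its membership rules, so no proof has to look inside the
  -- tabulated set that `ρ` produces.
  module StepRules (E E′ : Subset n) (E-anti : IsAntichain _⊑_ E) (E′-anti : IsAntichain _⊑_ E′)
                   (ρ⁺′ : ∀ {x} → MinimalOutside E x → x ∈ E′) (ρ⁻ : ∀ {x} → x ∈ E′ → MinimalOutside E x) where

    open Poset ⊑-isDecPartialOrder

    private
      ρ⁺ : ∀ {x} → OutsideIdeal E x → (∀ y → OutsideIdeal E y → y ⊑ x → y ≡ x) → x ∈ E′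
      ρ⁺ out min = ρ⁺′ (out , min)

      avoids-both : ∀ {j C} → (∀ {i y} → On j i → Segment i y → y ∉ C) → Avoids C (inject₁ j) × Avoids C (suc j)
      avoids-both f = (λ { (_ , s , y∈) → f (inj₁ refl) s y∈ }) , (λ { (_ , s , y∈) → f (inj₂ refl) s y∈ })

    ρ-bottom : ∀ {j x} → Joint j x → Even (inject₁ j) → x ∈ E′ ⇔ (Avoids E (inject₁ j) × Avoids E (suc j))
    ρ-bottom {j} {x} p e = mk⇔
      (λ x∈ → avoids-both {j} {E} λ {i} {y} on s y∈ → proj₁ (ρ⁻ x∈) (y , y∈ , joint-below {i = i} p e on s))
      (λ (av , av′) → ρ⁺ (λ (y , y∈ , x⊑y) → [ (λ s → av (y , s , y∈)) , (λ s → av′ (y , s , y∈)) ]′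
                           (above-joint p e x⊑y))
                         (λ y _ y⊑x → joint-minimal p e y⊑x))

    -- Everything in the two rows of a peak `x` lies below `x`, hence in the ideal once `x` is in
    -- `E`. Conversely, if `x` is not in `E`, maximality puts it outside the ideal, and a minimal
    -- outside element below it lies in one of the two rows and in `E′`.
    ρ-top : ∀ {j x} → Joint j x → Odd (inject₁ j) → x ∈ E ⇔ (Avoids E′ (inject₁ j) × Avoids E′ (suc j))
    ρ-top {j} {x} p o = mk⇔
      (λ x∈ → avoids-both {j} {E′} λ {i} {y} on s y∈ → proj₁ (ρ⁻ y∈) (x , x∈ , joint-above {i = i} p o on s))
      (λ av → decidable-stable (x ∈? E) λ x∉ →
        let m , min , m⊑x = minimal-below (outsideIdeal? E) {x} λ { (y , y∈ , x⊑y) →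
                              x∉ (subst (_∈ E) (sym (joint-maximal p o x⊑y)) y∈) }
            m∈ = ρ⁺′ min
        in [ (λ s → proj₁ av (m , s , m∈)) , (λ s → proj₂ av (m , s , m∈)) ]′ (below-joint p o m⊑x))

    -- At interior heights only row `i` matters. An element `x` of `E` puts all heights up to `h`
    -- into the ideal and, by the antichain property, leaves out `y`. Conversely, minimality of `y`
    -- puts `x` into the ideal, and a generator higher than `x` would put `y` there too.
    ρ-grow : ∀ {i h x y} → 0 < h → suc h < α i → At i h x → At i (suc h) y → x ∈ E ⇔ y ∈ E′
    ρ-grow {i} {h} {x} {y} 0<h lt a b = mk⇔ to from
      where
      to : x ∈ E → y ∈ E′
      to x∈ = ρ⁺ out min
        where
        out : OutsideIdeal E y
        out (z , z∈ , y⊑z) with above-at (s≤s z≤n) b y⊑z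
        ... | h′ , c , le with E-anti x∈ z∈ (at-⊑ a c (<⇒≤ le))
        ...   | refl = <⇒≢ le (height-unique a c)
        min : ∀ w → OutsideIdeal E w → w ⊑ y → w ≡ y
        min w w∉ w⊑y with below-at lt b w⊑y
        ... | h′ , c , le with m≤n⇒m<n∨m≡n le
        ...   | inj₁ h′<  = contradiction (x , x∈ , at-⊑ c a (≤-pred h′<)) w∉
        ...   | inj₂ refl = at-unique c b
      from : y ∈ E′ → x ∈ E
      from y∈ with ρ⁻ y∈
      -- If `x` were outside the ideal, minimality would identify it with `y`, which has a different
      -- height.
      ... | y∉ , min with decidable-stable (inIdeal? E x) (λ x∉ →
                            <⇒≢ (n<1+n h) (height-unique (subst (At i h) (min x x∉ (at-⊑ a b (n≤1+n h))) a) b))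
      ...   | z , z∈ , x⊑z with above-at 0<h a x⊑z
      ...     | h′ , c , le with m≤n⇒m<n∨m≡n le
      ...       | inj₁ h<   = contradiction (z , z∈ , at-⊑ b c h<) y∉
      ...       | inj₂ refl = subst (_∈ E) (at-unique c a) z∈

    -- Only a valley of the row can lie strictly below height 1. So `y` is minimal outside the ideal
    -- when `y` is outside and the valley, if there is one, is inside: either the valley generates
    -- that part itself, or the row avoids `E` and the valley is covered from its other row.
    ρ-start : ∀ {i y} → 1 < α i → At i 1 y →
              y ∈ E′ ⇔ ((∃[ x ] At i 0 x × x ∈ E) ⊎ (Avoids E i × ¬ (∃[ x ] At i 0 x × x ∈ E′)))
    ρ-start {i} {y} lt b = mk⇔ to from
      where
      to : y ∈ E′ → (∃[ x ] At i 0 x × x ∈ E) ⊎ (Avoids E i × ¬ (∃[ x ] At i 0 x × x ∈ E′))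
      to y∈ with any? (λ x → at? i 0 x ×-dec x ∈? E)
      ... | yes bot = inj₁ bot
      ... | no ¬bot = inj₂ (avoids , λ { (x , a , x∈) →
              contradiction (height-unique (subst (At i 0) (E′-anti x∈ y∈ (at-⊑ a b z≤n)) a) b) λ () })
        where
        avoids : Avoids E i
        avoids (z , s , z∈) with segment-at {i} s
        ... | zero  , c = ¬bot (z , c , z∈)
        ... | suc _ , c = proj₁ (ρ⁻ y∈) (z , z∈ , at-⊑ b c (s≤s z≤n))
      minimal : (∀ {w} → At i 0 w → ¬ OutsideIdeal E w) → ∀ w → OutsideIdeal E w → w ⊑ y → w ≡ y
      minimal bot w w∉ w⊑y with below-at lt b w⊑y
      ... | zero        , c , _        = contradiction w∉ (bot c)
      ... | suc zero    , c , _        = at-unique c b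
      ... | suc (suc _) , _ , s≤s ()
      from : (∃[ x ] At i 0 x × x ∈ E) ⊎ (Avoids E i × ¬ (∃[ x ] At i 0 x × x ∈ E′)) → y ∈ E′
      from (inj₁ (x , a , x∈)) = ρ⁺ out (minimal λ c w∉ → w∉ (x , x∈ , at-⊑ c a z≤n))
        where
        out : OutsideIdeal E y
        out (z , z∈ , y⊑z) with E-anti x∈ z∈ (at-⊑ a b z≤n ◅◅ y⊑z)
        ... | refl with ⊑-antisym y⊑z (at-⊑ a b z≤n)
        ...   | refl = contradiction (height-unique a b) λ ()
      -- A valley outside the ideal would be minimal there and hence lie in `E′`, contrary to
      -- `¬bot`.
      from (inj₂ (av , ¬bot)) = ρ⁺
        (λ { (z , z∈ , y⊑z) → av (z , at-segment (proj₁ (proj₂ (above-at (s≤s z≤n) b y⊑z))) , z∈) })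
        (minimal λ {w} c w∉ → ¬bot (w , c , ρ⁺ w∉ λ v _ v⊑w →
          let _ , p , e , _ = bottom-joint c in joint-minimal p e v⊑w))

    step-next : Next E E′
    step-next = record { grow = ρ-grow ; start = ρ-start ; bottom = ρ-bottom ; top = ρ-top }

  ρ-next : ∀ A → Next (elements A) (elements (ρ A))
  ρ-next A = StepRules.step-next (elements A) (elements (ρ A)) (antichain A) (antichain (ρ A))
    (∈-subsetOf⁺ member?) (∈-subsetOf⁻ member?)
    where
    open Poset ⊑-isDecPartialOrder
    member? = minimal? (outsideIdeal? (elements A))

  open Next
  open Equivalence

  -- Determinism of the local rules

  bottom-same : ∀ {A B C} → Next A B → Next A C → ∀ {i x} → At i 0 x → x ∈ B → x ∈ C
  bottom-same N M a x∈ = let _ , p , e , _ = bottom-joint a in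
    from (bottom M p e) (to (bottom N p e) x∈)

  -- By cases on the height: `grow` reduces membership at heights above 1 to `A`, and `start` refers
  -- to the new set only through the valley, which `bottom-same` settles in both directions.
  non-top-same : ∀ {A B C} → Next A B → Next A C → ∀ {i h x} → At i h x → h < α i → x ∈ B → x ∈ C
  non-top-same N M {h = zero} a _ x∈ = bottom-same N M a x∈
  non-top-same N M {h = suc zero} a lt x∈ with to (start N lt a) x∈
  ... | inj₁ bot         = from (start M lt a) (inj₁ bot)
  ... | inj₂ (av , ¬bot) = from (start M lt a)
    (inj₂ (av , λ { (z , c , z∈) → ¬bot (z , c , bottom-same M N c z∈) }))
  non-top-same N M {i} {suc (suc h)} a lt x∈ with at-exists {i} {suc h} (s≤s z≤n) (<⇒≤ lt)
  ... | _ , b = to (grow M (s≤s z≤n) lt b a) (from (grow N (s≤s z≤n) lt b a) x∈)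

  -- Only peaks remain. If a peak `x` of `B` were missing from `C`, then `C` would avoid both rows
  -- of `x`, because any non-top element of `C` there would lie in `B` below `x`. Then `top` places
  -- `x` in `A`, which in turn forces `B` to avoid the rows of `x`.
  next-deterministic : ∀ {A B C} → Next A B → Next A C → IsAntichain _⊑_ B → ∀ {x} → x ∈ B → x ∈ C
  next-deterministic {A} {B} {C} N M anti {x} x∈ with row-of x
  ... | i , h , a with m≤n⇒m<n∨m≡n (at-≤ a)
  ...   | inj₁ lt = non-top-same N M a lt x∈
  ...   | inj₂ refl with top-joint a
  ...     | j , p , o , _ = decidable-stable (x ∈? C) λ x∉ →
    let avoids : ∀ {i′} → On j i′ → Avoids C i′
        avoids {i′} on (y , s , y∈) =
          let h′ , b = segment-at {i′} s in
          [ (λ lt → x∉ (subst (_∈ C) (anti (non-top-same M N b lt y∈) x∈ (joint-above {i = i′} p o on s)) y∈))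
          , (λ eq → x∉ (subst (_∈ C) (at-unique (subst (λ m → At i′ m y) eq b) (joint-top p o on)) y∈))
          ]′ (m≤n⇒m<n∨m≡n (at-≤ b))
    in proj₁ (to (top N p o) (from (top M p o) (avoids (inj₁ refl) , avoids (inj₂ refl))))
         (x , joint-segment p (inj₁ refl) , x∈)

-- Offsets of integer columns

k-m+m : ∀ k m → k ℤ.- m ℤ.+ m ≡ k
k-m+m k m = trans (ℤ.+-assoc k (ℤ.- m) m) (trans (cong (λ z → k ℤ.+ z) (ℤ.+-inverseˡ m)) (ℤ.+-identityʳ k))

k+m-m : ∀ k m → k ℤ.+ m ℤ.- m ≡ k
k+m-m k m = trans (ℤ.+-assoc k m (ℤ.- m)) (trans (cong (λ z → k ℤ.+ z) (ℤ.+-inverseʳ m)) (ℤ.+-identityʳ k))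

k+m+n : ∀ k m n → k ℤ.+ m ℤ.+ n ≡ k ℤ.+ n ℤ.+ m
k+m+n k m n = trans (ℤ.+-assoc k m n) (trans (cong (λ z → k ℤ.+ z) (ℤ.+-comm m n)) (sym (ℤ.+-assoc k n m)))

k+h+1 : ∀ k h → k ℤ.+ + h ℤ.+ + 1 ≡ k ℤ.+ + suc h
k+h+1 k h = trans (ℤ.+-assoc k (+ h) (+ 1)) (cong (λ m → k ℤ.+ + m) (+-comm h 1))

+-cancelʳ : ∀ k l m → k ℤ.+ m ≡ l ℤ.+ m → k ≡ l
+-cancelʳ k l m eq = trans (sym (k+m-m k m)) (trans (cong (λ z → z ℤ.- m) eq) (k+m-m l m))

offset-injective : ∀ l {h h′} → l ℤ.+ + h ≡ l ℤ.+ + h′ → h ≡ h′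
offset-injective l {h} {h′} eq = ℤ.+-injective (+-cancelʳ (+ h) (+ h′) l
  (trans (ℤ.+-comm (+ h) l) (trans eq (ℤ.+-comm l (+ h′)))))

k<k+1 : ∀ k → k ℤ.< k ℤ.+ + 1
k<k+1 k = ℤ.suc[i]≤j⇒i<j (ℤ.≤-reflexive (ℤ.+-comm (+ 1) k))

<⇒+1≤ : ∀ {k l} → k ℤ.< l → k ℤ.+ + 1 ℤ.≤ l
<⇒+1≤ {k} k<l = subst (λ z → z ℤ.≤ _) (ℤ.+-comm (+ 1) k) (ℤ.i<j⇒suc[i]≤j k<l)

<+1⇒≤ : ∀ {k l} → k ℤ.< l ℤ.+ + 1 → k ℤ.≤ l
<+1⇒≤ {k} {l} k<l+1 = ℤ.≮⇒≥ λ l<k → ℤ.<-irrefl refl (ℤ.<-≤-trans k<l+1 (<⇒+1≤ l<k))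

≤⇒offset : ∀ {l k} → l ℤ.≤ k → ∃[ h ] k ≡ l ℤ.+ + h
≤⇒offset {l} {k} l≤k = ℤ.∣ k ℤ.- l ∣ , sym (trans (cong (λ z → l ℤ.+ z) (ℤ.0≤i⇒+∣i∣≡i (ℤ.i≤j⇒0≤j-i l≤k)))
  (trans (ℤ.+-comm l (k ℤ.- l)) (k-m+m k l)))

offset-< : ∀ l {h m} → l ℤ.+ + h ℤ.< l ℤ.+ + m → h < m
offset-< l lt = ≰⇒> λ m≤h → ℤ.<-irrefl refl (ℤ.<-≤-trans lt (ℤ.+-monoʳ-≤ l (ℤ.+≤+ m≤h)))

<∸1⇒suc< : ∀ {h a} → h < a ∸ 1 → suc h < a
<∸1⇒suc< {a = suc _} p = s≤s p

-- Pictures: tiles read off from columns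

module Display {r} (α : Fin (suc r) → ℕ) (α-pos : ∀ i → 1 ≤ α i) where

  open Fence α
  open FenceProperties α α-pos
  open LocalRules α α-pos
  open Tilings α

  -- The tile over one square, computed from its own column alone: an element of height `suc h`
  -- occupies square `h` of a black tile, which fixes the start `l` without consulting neighbouring
  -- columns.
  data Shows (C : Subset n) (i : Row) (k : ℤ) : Tile → Set where
    none     : Avoids C i → Shows C i k (yellow i k)
    shared   : ∀ {j x} → Joint j x → On j i → x ∈ C → Shows C i k (red j k)
    unshared : ∀ {h l x} .(w : 1 < α i) → At i (suc h) x → suc h < α i → x ∈ C →
               k ≡ l ℤ.+ + h → Shows C i k (black i w l)

  shows-exists : ∀ C i k → ∃[ t ] Shows C i k t
  shows-exists C i k with any? (λ x → segment? i x ×-dec x ∈? C)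
  ... | no av = yellow i k , none av
  ... | yes (x , s , x∈) with joint⊎interior {i} s
  ...   | inj₁ (j , p , on) = red j k , shared p on x∈
  ...   | inj₂ (suc h , a , _ , lt) = black i (≤-<-trans (s≤s z≤n) lt) (k ℤ.- + h)
          , unshared _ a lt x∈ (sym (k-m+m k (+ h)))

  shows-covers : ∀ {C i k t} → Shows C i k t → Covers t i k
  shows-covers (none _)        = refl , refl
  shows-covers (shared _ on _) = on , refl
  shows-covers {i = i} (unshared {h} {l} w a lt x∈ refl) =
    refl , ℤ.i≤i+j l (+ h) , ℤ.+-monoʳ-< l (ℤ.+<+ (∸-monoˡ-≤ 1 lt))

  -- A segment is a chain, so an antichain meets it at most once.
  same-row : ∀ {C i x y} → IsAntichain _⊑_ C → Segment i x → Segment i y → x ∈ C → y ∈ C → x ≡ y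
  same-row {i = i} anti s t x∈ y∈ with segment-at {i} s | segment-at {i} t
  ... | h , a | h′ , b with ≤-total h h′
  ...   | inj₁ le = anti x∈ y∈ (at-⊑ a b le)
  ...   | inj₂ ge = sym (anti y∈ x∈ (at-⊑ b a ge))

  same-height : ∀ {C i h h′ x y} → IsAntichain _⊑_ C → At i h x → At i h′ y → x ∈ C → y ∈ C → h ≡ h′
  same-height {i = i} anti a b x∈ y∈ with same-row {i = i} anti (at-segment a) (at-segment b) x∈ y∈
  ... | refl = height-unique a b

  shows-unique : ∀ {C i k t t′} → IsAntichain _⊑_ C → Shows C i k t → Shows C i k t′ → t ≡ t′
  shows-unique anti (none _) (none _) = refl
  shows-unique {i = i} anti (none av) (shared p on x∈) = contradiction (_ , joint-segment {i = i} p on , x∈) av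
  shows-unique anti (none av) (unshared _ a _ x∈ _) = contradiction (_ , at-segment a , x∈) av
  shows-unique {i = i} anti (shared p on x∈) (none av) = contradiction (_ , joint-segment {i = i} p on , x∈) av
  shows-unique {i = i} anti (shared p on x∈) (shared q on′ y∈)
    with same-row {i = i} anti (joint-segment p on) (joint-segment q on′) x∈ y∈
  ... | refl with joint-injective p q
  ...   | refl = refl
  shows-unique {i = i} anti (shared p on x∈) (unshared _ a lt y∈ _)
    with same-row {i = i} anti (joint-segment p on) (at-segment a) x∈ y∈
  ... | refl = contradiction p (interior-not-joint a (s≤s z≤n , lt))
  shows-unique anti (unshared _ a _ x∈ _) (none av) = contradiction (_ , at-segment a , x∈) av
  shows-unique {i = i} anti (unshared _ a lt x∈ _) (shared q on y∈)
    with same-row {i = i} anti (at-segment a) (joint-segment q on) x∈ y∈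
  ... | refl = contradiction q (interior-not-joint a (s≤s z≤n , lt))
  shows-unique anti (unshared {h} {l} _ a _ x∈ e) (unshared {l = l′} _ b _ y∈ f) with same-height anti a b x∈ y∈
  ... | refl with +-cancelʳ l l′ (+ h) (trans (sym e) f)
  ...   | refl = refl

  -- `shown` claims a whole tile from any one of its squares and `shows` reads it back on all of
  -- them, so the agreement between neighbouring columns is built in.
  record IsPicture (R : Pred Tile 0ℓ) (col : ℤ → Subset n) : Set where
    field
      antichains : ∀ k → IsAntichain _⊑_ (col k)
      shows      : ∀ {t i k} → R t → Covers t i k → Shows (col k) i k t
      shown      : ∀ {t i k} → Shows (col k) i k t → R t

  picture-exact : ∀ {R col} → IsPicture R col → Exact R
  picture-exact {col = col} P i k = let t , sh = shows-exists (col k) i k in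
    t , (shown sh , shows-covers sh) , λ (r , c) → shows-unique (antichains k) sh (shows r c)
    where open IsPicture P

  tile-square : ∀ t → ∃[ i ] ∃[ k ] Covers t i k
  tile-square (yellow i k)  = i , k , refl , refl
  tile-square (red j k)     = inject₁ j , k , inj₁ refl , refl
  tile-square (black i w k) = i , k , refl , ℤ.≤-refl
    , subst (λ z → z ℤ.< k ℤ.+ + (α i ∸ 1)) (ℤ.+-identityʳ k)
        -- The side condition of `black` makes the length positive; being irrelevant, it has to be
        -- recomputed.
        (ℤ.+-monoʳ-< k (ℤ.+<+ (m<n⇒0<n∸m (recompute (1 <? α i) w))))

  pictures-agree : ∀ {R R′ col col′} → IsPicture R col → IsPicture R′ col′ → (∀ k → col k ≡ col′ k) →
                   ∀ {t} → R t → R′ t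
  pictures-agree P P′ same {t} rt = let i , k , c = tile-square t in
    IsPicture.shown P′ (subst (λ C → Shows C i k t) (same k) (IsPicture.shows P rt c))

  module PictureProperties {R col} (P : IsPicture R col) where

    open IsPicture P

    yellow⇒avoids : ∀ {i k} → R (yellow i k) → Avoids (col k) i
    yellow⇒avoids rt with shows rt (refl , refl)
    ... | none av = av

    red⇒∈ : ∀ {j x k} → R (red j k) → Joint j x → x ∈ col k
    red⇒∈ rt p with shows rt (inj₁ refl , refl)
    ... | shared q _ x∈ = subst (_∈ _) (joint-unique q p) x∈

    ∈⇒red : ∀ {j x k} → Joint j x → x ∈ col k → R (red j k)
    ∈⇒red p x∈ = shown (shared p (inj₁ refl) x∈)

    black⇒∈ : ∀ {i h x l k} .{w : 1 < α i} → R (black i w l) → At i (suc h) x → suc h < α i →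
              k ≡ l ℤ.+ + h → x ∈ col k
    black⇒∈ {h = h} {l = l} rt a lt refl
      with shows rt (refl , ℤ.i≤i+j l (+ h) , ℤ.+-monoʳ-< l (ℤ.+<+ (∸-monoˡ-≤ 1 lt)))
    ... | unshared _ b _ x∈ e with offset-injective l e
    ...   | refl = subst (_∈ _) (at-unique b a) x∈

    ∈⇒black : ∀ {i h x k} l .{w : 1 < α i} → At i (suc h) x → suc h < α i → k ≡ l ℤ.+ + h →
              x ∈ col k → R (black i w l)
    ∈⇒black l a lt e x∈ = shown (unshared _ a lt x∈ e)

    interior-not-red : ∀ {i j h x k} → R (red j k) → On j i → At i h x → Interior i h → x ∉ col k
    interior-not-red {i} {j} {k = k} rt on a int x∈ with joint-exists j
    ... | y , p with same-row {i = i} (antichains k) (at-segment a) (joint-segment p on) x∈ (red⇒∈ rt p)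
    ...   | refl = interior-not-joint a int p

    avoids-not-red : ∀ {i j k} → R (red j k) → On j i → ¬ Avoids (col k) i
    avoids-not-red {i} {j} rt on av = let y , p = joint-exists j in
      av (y , joint-segment {i = i} p on , red⇒∈ rt p)

-- Local rules against tiling conditions

module Characterization {r} (α : Fin (suc r) → ℕ) (α-pos : ∀ i → 1 ≤ α i) where

  open Fence α
  open FenceProperties α α-pos
  open LocalRules α α-pos
  open Display α α-pos
  open Tilings α
  open Equivalence

  allRed-[] : ∀ R {i a} → AllRed R i a a
  allRed-[] R k a≤k k<a = contradiction (ℤ.≤-<-trans a≤k k<a) (ℤ.<-irrefl refl)

  allRed-∷ʳ : ∀ R {i j a b} → AllRed R i a b → R (red j b) → On j i → AllRed R i a (b ℤ.+ + 1)
  allRed-∷ʳ R {b = b} reds rt on k a≤k k<b+1 with k ℤ.≟ b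
  ... | yes refl = _ , rt , on , refl
  ... | no k≢b   = reds k a≤k (ℤ.≤∧≢⇒< (<+1⇒≤ k<b+1) k≢b)

  module RulesToTiling {R col} (P : IsPicture R col) (next : ∀ k → Next (col k) (col (k ℤ.+ + 1))) where

    open IsPicture P
    open PictureProperties P

    prev : ∀ k → Next (col (k ℤ.- + 1)) (col k)
    prev k = subst (λ l → Next (col (k ℤ.- + 1)) (col l)) (k-m+m k (+ 1)) (next (k ℤ.- + 1))

    -- After a yellow square the element `y` of height 1 appears in column `k + 1`, or in column
    -- `k + 2` if a valley enters at `k + 1`. Both columns are at most `l`, where only red and
    -- yellow squares are available.
    yellow-alternates : ∀ {i} → 1 < α i → ∀ {k l} → k ℤ.< l → R (yellow i k) → R (yellow i l) →
                        ¬ AllRed R i (k ℤ.+ + 1) l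
    yellow-alternates {i} lt {k} {l} k<l yk yl reds
      with at-exists {i} {1} (s≤s z≤n) lt | any? (λ x → at? i 0 x ×-dec x ∈? col (k ℤ.+ + 1))
    ... | y , b | bot? = go bot?
      where
      absent : ∀ m → k ℤ.+ + 1 ℤ.≤ m → m ℤ.≤ l → y ∉ col m
      absent m lo hi y∈ with m ℤ.≟ l
      ... | yes refl = yellow⇒avoids yl (y , at-segment b , y∈)
      ... | no m≢l   = let _ , rt , on , _ = reds m lo (ℤ.≤∧≢⇒< hi m≢l) in
                       interior-not-red rt on b (s≤s z≤n , lt) y∈
      go : Dec (∃[ x ] At i 0 x × x ∈ col (k ℤ.+ + 1)) → _
      go (no ¬bot) = absent (k ℤ.+ + 1) ℤ.≤-refl (<⇒+1≤ k<l)
        (from (Next.start (next k) lt b) (inj₂ (yellow⇒avoids yk , ¬bot)))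
      go (yes (x , a , x∈)) = absent (k ℤ.+ + 1 ℤ.+ + 1) (ℤ.<⇒≤ (k<k+1 _)) (<⇒+1≤ k+1<l)
        (from (Next.start (next (k ℤ.+ + 1)) lt b) (inj₁ (x , a , x∈)))
        where
        k+1<l : k ℤ.+ + 1 ℤ.< l
        -- Column `k + 1` contains the valley `x` of row `i`, so it cannot be the yellow column `l`.
        k+1<l = ℤ.≤∧≢⇒< (<⇒+1≤ k<l) λ { refl → yellow⇒avoids yl (x , at-segment a , x∈) }

    -- A black tile starting at `l` needs row `i` to be empty in column `l - 1`, or in column
    -- `l - 2` with a valley between. From the last square of the earlier tile up to `l` every
    -- column is occupied.
    black-alternates : ∀ {i} (lt : 1 < α i) {k l} → k ℤ.< l → R (black i lt k) → R (black i lt l) →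
                       ¬ AllRed R i (k ℤ.+ + (α i ∸ 1)) l
    black-alternates {i} lt {k} {l} k<l bk bl reds
      -- `y` belongs to the first square of a black tile; `z`, at height `α i - 1`, belongs to the
      -- last.
      with at-exists {i} {1} (s≤s z≤n) lt | at-exists {i} {suc (α i ∸ 2)} (s≤s z≤n) (≤-reflexive (m+[n∸m]≡n lt))
    ... | y , b | z , d = go (to (Next.start (prev l) lt b) y∈)
      where
      c : ℕ
      c = α i ∸ 2
      c+2 : suc (suc c) ≡ α i
      c+2 = m+[n∸m]≡n lt
      length : α i ∸ 1 ≡ suc c
      length = cong (_∸ 1) (sym c+2)
      y∈ : y ∈ col l
      y∈ = black⇒∈ bl b lt (sym (ℤ.+-identityʳ l))
      z∈ : z ∈ col (k ℤ.+ + c)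
      z∈ = black⇒∈ bk d (≤-reflexive c+2) refl
      end≤l : k ℤ.+ + suc c ℤ.≤ l
      -- Otherwise square `l` would show two black tiles with different starts.
      end≤l = ℤ.≮⇒≥ λ l< → contradiction
        (shows-unique (antichains l) (shows bk (refl , ℤ.<⇒≤ k<l , subst (λ m → l ℤ.< k ℤ.+ + m) (sym length) l<))
                                     (unshared {l = l} lt b lt y∈ (sym (ℤ.+-identityʳ l))))
        λ { refl → ℤ.<-irrefl refl k<l }
      occupied : ∀ p → k ℤ.+ + c ℤ.≤ p → p ℤ.< l → ¬ Avoids (col p) i
      occupied p lo hi av with p ℤ.≟ k ℤ.+ + c
      ... | yes refl = av (z , at-segment d , z∈)
      ... | no p≢    = let _ , rt , on , _ = reds p start≤p hi in avoids-not-red rt on av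
        where
        start≤p : k ℤ.+ + (α i ∸ 1) ℤ.≤ p
        start≤p = subst (λ z → z ℤ.≤ p) (trans (k+h+1 k c) (cong (λ m → k ℤ.+ + m) (sym length)))
          (<⇒+1≤ (ℤ.≤∧≢⇒< lo (p≢ ∘ sym)))
      pred< : ∀ m → m ℤ.- + 1 ℤ.< m
      pred< m = subst (λ z → m ℤ.- + 1 ℤ.< z) (k-m+m m (+ 1)) (k<k+1 _)
      ≤pred : ∀ {m n} → m ℤ.< n → m ℤ.≤ n ℤ.- + 1
      ≤pred {m} {n} lt = <+1⇒≤ (subst (λ z → m ℤ.< z) (sym (k-m+m n (+ 1))) lt)
      lo₁ : k ℤ.+ + c ℤ.≤ l ℤ.- + 1
      lo₁ = ≤pred (ℤ.<-≤-trans (ℤ.+-monoʳ-< k (ℤ.+<+ (n<1+n c))) end≤l)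
      go : (∃[ x ] At i 0 x × x ∈ col (l ℤ.- + 1)) ⊎ (Avoids (col (l ℤ.- + 1)) i × _) → _
      go (inj₂ (av , _)) = occupied (l ℤ.- + 1) lo₁ (pred< l) av
      go (inj₁ (x , a , x∈)) with bottom-joint a
      -- Column `l - 1` holds a valley, so it is not the column of `z`; hence `l - 2` is still in
      -- the occupied range.
      ... | j , p , e , on = occupied (l ℤ.- + 1 ℤ.- + 1) (≤pred (ℤ.≤∧≢⇒< lo₁ λ eq →
              contradiction (same-height (antichains _) a d x∈ (subst (λ m → z ∈ col m) eq z∈)) λ ()))
              (ℤ.<-trans (pred< _) (pred< l)) (avoids-on on (to (Next.bottom (prev (l ℤ.- + 1)) p e) x∈))

    red-rule : ∀ j k → R (red j k) ⇔ (Even (inject₁ j) × TwoYellow R j (k ℤ.- + 1) ⊎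
                                       Odd (inject₁ j) × TwoYellow R j (k ℤ.+ + 1))
    red-rule j k with joint-exists j
    ... | x , p = mk⇔ fwd λ
      { (inj₁ (e , y , y′)) → ∈⇒red p (from (Next.bottom (prev k) p e) (yellow⇒avoids y , yellow⇒avoids y′))
      ; (inj₂ (o , y , y′)) → ∈⇒red p (from (Next.top (next k) p o) (yellow⇒avoids y , yellow⇒avoids y′)) }
      where
      fwd : R (red j k) → _
      fwd rt with odd⊎even (inject₁ j)
      ... | inj₁ o = let av , av′ = to (Next.top (next k) p o) (red⇒∈ rt p) in
                     inj₂ (o , shown (none av) , shown (none av′))
      ... | inj₂ e = let av , av′ = to (Next.bottom (prev k) p e) (red⇒∈ rt p) in
                     inj₁ (e , shown (none av) , shown (none av′))

    isTiling : IsTiling R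
    isTiling = record
      { exact      = picture-exact P
      ; alternates = λ i lt → yellow-alternates lt , λ _ → black-alternates lt
      ; redRule    = red-rule
      }

  module TilingToRules {R col} (P : IsPicture R col) (T : IsTiling R) where

    open IsPicture P
    open IsTiling T
    open PictureProperties P

    red-before : ∀ {j l} → R (red j l) → Even (inject₁ j) → TwoYellow R j (l ℤ.- + 1)
    red-before {j} {l} rt e with to (redRule j l) rt
    ... | inj₁ (_ , ys) = ys
    ... | inj₂ (o , _)  = contradiction e (odd∧even (inject₁ j) o)

    red-after : ∀ {j l} → R (red j l) → Odd (inject₁ j) → TwoYellow R j (l ℤ.+ + 1)
    red-after {j} {l} rt o with to (redRule j l) rt
    ... | inj₁ (e , _)  = contradiction e (odd∧even (inject₁ j) o)
    ... | inj₂ (_ , ys) = ys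

    on-yellow : ∀ {j i l} → On j i → TwoYellow R j l → R (yellow i l)
    on-yellow (inj₁ refl) (y , _) = y
    on-yellow (inj₂ refl) (_ , y) = y

    module _ (k : ℤ) where

      -- The two memberships are read from consecutive squares of one and the same black tile.
      next-grow : ∀ {i h x y} → 0 < h → suc h < α i → At i h x → At i (suc h) y →
                  x ∈ col k ⇔ y ∈ col (k ℤ.+ + 1)
      next-grow {i} {suc h} {x} {y} _ lt a b = mk⇔
        (λ x∈ → black⇒∈ (∈⇒black l {w} a (<⇒≤ lt) k≡ x∈) b lt k+1≡)
        (λ y∈ → black⇒∈ (∈⇒black l {w} b lt k+1≡ y∈) a (<⇒≤ lt) k≡)
        where
        w : 1 < α i
        w = ≤-<-trans (s≤s z≤n) lt
        l : ℤ
        l = k ℤ.- + h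
        k≡ : k ≡ l ℤ.+ + h
        k≡ = sym (k-m+m k (+ h))
        k+1≡ : k ℤ.+ + 1 ≡ l ℤ.+ + suc h
        k+1≡ = trans (cong (λ z → z ℤ.+ + 1) k≡) (k+h+1 l h)

      next-bottom : ∀ {j x} → Joint j x → Even (inject₁ j) →
                    x ∈ col (k ℤ.+ + 1) ⇔ (Avoids (col k) (inject₁ j) × Avoids (col k) (suc j))
      next-bottom {j} p e = mk⇔
        (λ x∈ → let y , y′ = red-before (∈⇒red p x∈) e in avoids y , avoids y′)
        (λ (av , av′) → red⇒∈ (from (redRule j (k ℤ.+ + 1)) (inj₁ (e , yellow-at av , yellow-at av′))) p)
        where
        avoids : ∀ {i} → R (yellow i (k ℤ.+ + 1 ℤ.- + 1)) → Avoids (col k) i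
        avoids {i} y = yellow⇒avoids (subst (λ l → R (yellow i l)) (k+m-m k (+ 1)) y)
        yellow-at : ∀ {i} → Avoids (col k) i → R (yellow i (k ℤ.+ + 1 ℤ.- + 1))
        yellow-at {i} av = subst (λ l → R (yellow i l)) (sym (k+m-m k (+ 1))) (shown (none av))

      next-top : ∀ {j x} → Joint j x → Odd (inject₁ j) →
                 x ∈ col k ⇔ (Avoids (col (k ℤ.+ + 1)) (inject₁ j) × Avoids (col (k ℤ.+ + 1)) (suc j))
      next-top {j} p o = mk⇔
        (λ x∈ → let y , y′ = red-after (∈⇒red p x∈) o in yellow⇒avoids y , yellow⇒avoids y′)
        (λ (av , av′) → red⇒∈ (from (redRule j k) (inj₂ (o , shown (none av) , shown (none av′)))) p)

      -- By alternation, the last non-red square before a black tile is yellow. Each direction runs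
      -- through what the adjacent column can show in row `i`; the red rule supplies a yellow square
      -- just before a valley and just after a peak.
      next-start : ∀ {i y} → 1 < α i → At i 1 y → y ∈ col (k ℤ.+ + 1) ⇔
                   ((∃[ x ] At i 0 x × x ∈ col k) ⊎ (Avoids (col k) i × ¬ (∃[ x ] At i 0 x × x ∈ col (k ℤ.+ + 1))))
      next-start {i} {y} lt b = mk⇔ fwd bwd
        where
        fwd : y ∈ col (k ℤ.+ + 1) → _
        fwd y∈ with shows-exists (col k) i k
        ... | _ , none av = inj₂ (av , λ (x , a , x∈) → contradiction (same-height (antichains _) a b x∈ y∈) λ ())
        ... | _ , shared {j} p on x∈ with odd⊎even (inject₁ j)
        ...   | inj₂ e = inj₁ (_ , joint-bottom p e on , x∈)
        ...   | inj₁ o = contradiction (y , at-segment b , y∈)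
                (yellow⇒avoids (on-yellow on (red-after (∈⇒red p x∈) o)))
        -- Before its last square the tile continues, giving column `k + 1` a height of at least 2
        -- instead of `y`; after its last square a second black tile would follow immediately.
        fwd y∈ | _ , unshared {h} {l} w a lt′ x∈ k≡ with m≤n⇒m<n∨m≡n lt′
        ...   | inj₁ lt″ with at-exists {i} {suc (suc h)} (s≤s z≤n) lt″
        ...     | z , d = contradiction
                  (same-height (antichains _) d b (to (next-grow (s≤s z≤n) lt″ a d) x∈) y∈) λ ()
        fwd y∈ | _ , unshared {h} {l} w a lt′ x∈ k≡ | inj₂ eq = contradiction
          (subst (λ z → AllRed R i z (k ℤ.+ + 1)) (sym end) (allRed-[] R))
          (proj₂ (alternates i lt) lt l<k+1 (∈⇒black l a lt′ k≡ x∈)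
            (∈⇒black (k ℤ.+ + 1) b lt (sym (ℤ.+-identityʳ _)) y∈))
          where
          l<k+1 : l ℤ.< k ℤ.+ + 1
          l<k+1 = ℤ.≤-<-trans (subst (λ z → l ℤ.≤ z) (sym k≡) (ℤ.i≤i+j l (+ h))) (k<k+1 k)
          end : l ℤ.+ + (α i ∸ 1) ≡ k ℤ.+ + 1
          end = trans (cong (λ m → l ℤ.+ + (m ∸ 1)) (sym eq))
                  (trans (sym (k+h+1 l h)) (cong (λ z → z ℤ.+ + 1) (sym k≡)))

        lower : ∀ {h x} → At i (suc (suc h)) x → suc (suc h) < α i → x ∈ col (k ℤ.+ + 1) →
                ∃[ z ] At i (suc h) z × z ∈ col k
        lower {h} a lt′ x∈ = let z , d = at-exists {i} {suc h} (s≤s z≤n) (<⇒≤ lt′) in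
          z , d , from (next-grow (s≤s z≤n) lt′ d a) x∈

        bwd : _ → y ∈ col (k ℤ.+ + 1)
        bwd (inj₁ (x , a , x∈)) with bottom-joint a
        -- The valley is red in column `k`, so row `i` is yellow in column `k - 1`, and no second
        -- yellow square may follow with only red ones between.
        ... | j , p , e , on = go (shows-exists (col (k ℤ.+ + 1)) i (k ℤ.+ + 1))
          where
          rt : R (red j k)
          rt = ∈⇒red p x∈
          yk-1 : R (yellow i (k ℤ.- + 1))
          yk-1 = on-yellow on (red-before rt e)
          k-1<k+1 : k ℤ.- + 1 ℤ.< k ℤ.+ + 1
          k-1<k+1 = ℤ.<-trans (subst (λ z → k ℤ.- + 1 ℤ.< z) (k-m+m k (+ 1)) (k<k+1 _)) (k<k+1 k)
          red-k : AllRed R i (k ℤ.- + 1 ℤ.+ + 1) (k ℤ.+ + 1)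
          red-k = subst (λ z → AllRed R i z (k ℤ.+ + 1)) (sym (k-m+m k (+ 1))) (allRed-∷ʳ R (allRed-[] R) rt on)
          go : ∃[ t ] Shows (col (k ℤ.+ + 1)) i (k ℤ.+ + 1) t → y ∈ col (k ℤ.+ + 1)
          go (_ , none av) = contradiction red-k
            (proj₁ (alternates i lt) k-1<k+1 yk-1 (shown (none av)))
          -- A peak in column `k + 1` would make column `k + 2` that second yellow square; a valley
          -- there would need row `i` empty in column `k`, where `x` lies.
          go (_ , shared {j′} q on′ z∈) with odd⊎even (inject₁ j′)
          ... | inj₁ o = contradiction (allRed-∷ʳ R red-k (∈⇒red q z∈) on′)
                (proj₁ (alternates i lt) (ℤ.<-trans k-1<k+1 (k<k+1 _)) yk-1
                  (on-yellow on′ (red-after (∈⇒red q z∈) o)))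
          ... | inj₂ e′ = contradiction (x , at-segment a , x∈) (avoids-on on′ (to (next-bottom q e′) z∈))
          go (_ , unshared {zero} w d lt′ z∈ _) = subst (_∈ _) (at-unique d b) z∈
          go (_ , unshared {suc h} w d lt′ z∈ _) = let _ , d′ , z′∈ = lower d lt′ z∈ in
            contradiction (same-height (antichains k) d′ a z′∈ x∈) λ ()
        bwd (inj₂ (av , ¬bot)) with shows-exists (col (k ℤ.+ + 1)) i (k ℤ.+ + 1)
        ... | _ , none av′ = contradiction (allRed-[] R)
              (proj₁ (alternates i lt) (k<k+1 k) (shown (none av)) (shown (none av′)))
        ... | _ , unshared {zero} w d lt′ z∈ _ = subst (_∈ _) (at-unique d b) z∈
        ... | _ , unshared {suc h} w d lt′ z∈ _ = let z , d′ , z′∈ = lower d lt′ z∈ in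
              contradiction (z , at-segment d′ , z′∈) av
        ... | _ , shared {j′} q on′ z∈ with odd⊎even (inject₁ j′)
        ...   | inj₂ e = contradiction (_ , joint-bottom q e on′ , z∈) ¬bot
        ...   | inj₁ o = contradiction (allRed-∷ʳ R (allRed-[] R) (∈⇒red q z∈) on′)
                (proj₁ (alternates i lt) (ℤ.<-trans (k<k+1 k) (k<k+1 _)) (shown (none av))
                  (on-yellow on′ (red-after (∈⇒red q z∈) o)))

      tiling-next : Next (col k) (col (k ℤ.+ + 1))
      tiling-next = record { grow = next-grow ; start = next-start ; bottom = next-bottom ; top = next-top }

-- Orbits and tilings: the map in both directions

module Bijection {r} (α : Fin (suc r) → ℕ) (α-pos : ∀ i → 1 ≤ α i) where

  open Fence α
  open FenceProperties α α-pos
  open LocalRules α α-pos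
  open Display α α-pos
  open Characterization α α-pos
  open Tilings α
  open Equivalence

  module OrbitPicture (A : Antichain) where

    col : ℤ → Subset n
    col k = elements (ρ^ k A)

    ρ-steps : ∀ k → Next (col k) (col (k ℤ.+ + 1))
    ρ-steps k = subst (Next (col k) ∘ elements) (sym ρ-at) (ρ-next (ρ^ k A))
      where
      ρ-at : ρ^ (k ℤ.+ + 1) A ≡ ρ (ρ^ k A)
      ρ-at = trans (cong (λ l → ρ^ l A) (ℤ.+-comm k (+ 1))) (ρ^-suc k A)

    -- Iterating `grow` both ways, one occupied square fills the whole black tile, as the
    -- quantification over `j` in `φ` requires.
    along-black : ∀ {i y x} l h → At i 1 y → At i (suc h) x → suc h < α i → y ∈ col l ⇔ x ∈ col (l ℤ.+ + h)
    along-black l zero b a lt rewrite ℤ.+-identityʳ l | at-unique a b = mk⇔ (λ z → z) (λ z → z)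
    along-black {i} {y} {x} l (suc h) b a lt with at-exists {i} {suc h} (s≤s z≤n) (<⇒≤ lt)
    ... | z , c = mk⇔
      (λ y∈ → subst (λ k → x ∈ col k) (k+h+1 l h) (to N (to IH y∈)))
      (λ x∈ → from IH (from N (subst (λ k → x ∈ col k) (sym (k+h+1 l h)) x∈)))
      where
      N : z ∈ col (l ℤ.+ + h) ⇔ x ∈ col (l ℤ.+ + h ℤ.+ + 1)
      N = Next.grow (ρ-steps (l ℤ.+ + h)) (s≤s z≤n) lt c a
      IH : y ∈ col l ⇔ z ∈ col (l ℤ.+ + h)
      IH = along-black l h b c (<⇒≤ lt)

    φ-shows : ∀ {t i k} → φ α A t → Covers t i k → Shows (col k) i k t
    φ-shows {yellow i k}  av (refl , refl) = none av
    φ-shows {red j k} (x , s , s′ , x∈) (on , refl) = shared (segments-joint s s′) on x∈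
    φ-shows {black i w l} f (refl , l≤k , k<) with ≤⇒offset l≤k
    ... | h , refl with offset-< l k<
    ...   | h< with f (fromℕ< h<)
    ...     | x , jth , x∈ = unshared w (subst (λ m → At i (suc m) x) (toℕ-fromℕ< h<) (jth-at jth))
                (<∸1⇒suc< h<) (subst (λ m → x ∈ col (l ℤ.+ + m)) (toℕ-fromℕ< h<) x∈) refl

    φ-shown : ∀ {t i k} → Shows (col k) i k t → φ α A t
    φ-shown (none av) = av
    φ-shown (shared p _ x∈) = _ , joint-segment p (inj₁ refl) , joint-segment p (inj₂ refl) , x∈
    φ-shown (unshared {h} {l} {x} w a lt x∈ refl) j
      with at-exists (s≤s z≤n) (≤-<-trans (s≤s z≤n) lt)
         | at-exists {_} {suc (toℕ j)} (s≤s z≤n) (<∸1⇒suc< (toℕ<n j))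
    ... | y , b | z , c = z , at-jth (toℕ j) c (<∸1⇒suc< (toℕ<n j)) ,
          to (along-black l (toℕ j) b c (<∸1⇒suc< (toℕ<n j))) (from (along-black l h b a lt) x∈)

    φ-picture : IsPicture (φ α A) col
    φ-picture = record { antichains = λ k → antichain (ρ^ k A) ; shows = φ-shows ; shown = φ-shown }

    φ-isTiling : IsTiling (φ α A)
    φ-isTiling = RulesToTiling.isTiling φ-picture ρ-steps

  module ShiftedPictures {R R′ : Pred Tile 0ℓ} {col col′ : ℤ → Subset n} (P : IsPicture R col)
                         (P′ : IsPicture R′ col′) (d : ℤ) (shift : ∀ t → R t → R′ (translate d t)) where

    open PictureProperties

    -- The single tile that displays `x` suffices to recover `x`: a red tile through its joint, a
    -- black one through its start and the height. Shifting the tile therefore shifts the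
    -- membership.
    shifted-∈ : ∀ {k x} → x ∈ col k → x ∈ col′ (k ℤ.+ d)
    shifted-∈ {k} {x} x∈ with row-of x
    ... | i , h , a with joint⊎interior {i} (at-segment a)
    ...   | inj₁ (j , p , _) = red⇒∈ P′ (shift _ (∈⇒red P p x∈)) p
    ...   | inj₂ (suc h , b , _ , lt) = black⇒∈ P′ (shift _ (∈⇒black P l {w} b lt (sym (k-m+m k (+ h))) x∈)) b lt
              (trans (cong (λ z → z ℤ.+ d) (sym (k-m+m k (+ h)))) (k+m+n l (+ h) d))
      where
      l : ℤ
      l = k ℤ.- + h
      w : 1 < α i
      w = ≤-<-trans (s≤s z≤n) lt

  φ-injective : ∀ {A B} → φ α A ∼ φ α B → Setoid._≈_ Orbits A B
  -- Column `d` for `B` equals column 0 for `A`: the first inclusion shifts by `- d`, the second by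
  -- `d`.
  φ-injective {A} {B} eq@(d , h) = Setoid.sym Orbits {B} {A} (d , elements-injective (⊆-antisym
      (λ x∈ → subst (λ k → _ ∈ elements (ρ^ k A)) (ℤ.+-inverseʳ d)
                (ShiftedPictures.shifted-∈ PB PA (proj₁ eq⁻) (λ t → to (proj₂ eq⁻ t)) {d} x∈))
      (λ x∈ → subst (λ k → _ ∈ elements (ρ^ k B)) (ℤ.+-identityˡ d)
                (ShiftedPictures.shifted-∈ PA PB d (λ t → to (h t)) {+ 0} x∈))))
    where
    PA = OrbitPicture.φ-picture A
    PB = OrbitPicture.φ-picture B
    eq⁻ : φ α B ∼ φ α A
    eq⁻ = ∼-sym {φ α A} {φ α B} eq

  -- Column `k` for `A` is column `k - m` for `ρ^ m A`, hence the translation by `- m`.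
  φ-cong : ∀ {A B} → Setoid._≈_ Orbits A B → φ α A ∼ φ α B
  φ-cong {A} (m , refl) = ℤ.- m , λ
    { (yellow i k) → along (λ C → ¬ (∃[ x ] Segment i x × x ∈ elements C)) (shift k)
    ; (red j k) → along (λ C → ∃[ x ] Segment (inject₁ j) x × Segment (suc j) x × x ∈ elements C) (shift k)
    ; (black i w l) →
        let shown-at : ∀ j → Antichain → Set
            shown-at j C = ∃[ x ] JthSmallest (Unshared i) (suc j) x × x ∈ elements C
            shift-black : ∀ j → ρ^ (l ℤ.+ + j) A ≡ ρ^ (l ℤ.- m ℤ.+ + j) (ρ^ m A)
            shift-black j = trans (shift (l ℤ.+ + j)) (cong (λ k → ρ^ k (ρ^ m A)) (k+m+n l (+ j) (ℤ.- m)))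
        in mk⇔ (λ f j → to (along (shown-at (toℕ j)) (shift-black (toℕ j))) (f j))
               (λ f j → from (along (shown-at (toℕ j)) (shift-black (toℕ j))) (f j)) }
    where
    along : ∀ (Q : Antichain → Set) {C D} → C ≡ D → Q C ⇔ Q D
    along Q refl = mk⇔ (λ q → q) (λ q → q)
    shift : ∀ k → ρ^ k A ≡ ρ^ (k ℤ.- m) (ρ^ m A)
    shift k = trans (cong (λ l → ρ^ l A) (sym (k-m+m k m))) (ρ^-+ (k ℤ.- m) m A)

  _≟ᵗ_ : DecidableEquality Tile
  yellow i k  ≟ᵗ yellow i′ k′  =
    map′ (λ { (refl , refl) → refl }) (λ { refl → refl , refl }) (i ≟ᶠ i′ ×-dec k ℤ.≟ k′)
  yellow _ _  ≟ᵗ red _ _       = no λ ()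
  yellow _ _  ≟ᵗ black _ _ _   = no λ ()
  red _ _     ≟ᵗ yellow _ _    = no λ ()
  red j k     ≟ᵗ red j′ k′     =
    map′ (λ { (refl , refl) → refl }) (λ { refl → refl , refl }) (j ≟ᶠ j′ ×-dec k ℤ.≟ k′)
  red _ _     ≟ᵗ black _ _ _   = no λ ()
  black _ _ _ ≟ᵗ yellow _ _    = no λ ()
  black _ _ _ ≟ᵗ red _ _       = no λ ()
  black i _ k ≟ᵗ black i′ _ k′ =
    map′ (λ { (refl , refl) → refl }) (λ { refl → refl , refl }) (i ≟ᶠ i′ ×-dec k ℤ.≟ k′)

  -- Reading an orbit off a tiling

  module TilingOrbit {T : Pred Tile 0ℓ} (isT : IsTiling T) where

    open IsTiling isT

    same-tile : ∀ {t t′ i k} → T t → Covers t i k → T t′ → Covers t′ i k → t ≡ t′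
    same-tile {i = i} {k} tt c tt′ c′ = let _ , _ , unique = exact i k in
      trans (sym (unique (tt , c))) (unique (tt′ , c′))

    -- Exactness names the unique tile of `T` over some square of `t`, and equality of tiles is
    -- decidable.
    T? : Decidable₁ T
    T? t with tile-square t
    ... | i , k , c with exact i k
    ...   | t₀ , (tt₀ , _) , unique = map′ (λ { refl → tt₀ }) (λ tt → unique (tt , c)) (t₀ ≟ᵗ t)

    wide : ∀ i → Fin (α i ∸ 1) → 1 < α i
    wide i h = ≤-<-trans (s≤s z≤n) (<∸1⇒suc< (toℕ<n h))

    -- Only finitely many tiles are consulted for each element, so `T?` makes the columns genuine
    -- finite subsets. Square `toℕ h` of a tile lies in column `k` exactly when the tile starts at
    -- `k - toℕ h`.
    Displayed : ℤ → Pred (Fin n) 0ℓ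
    Displayed k x = (∃[ j ] Joint j x × T (red j k)) ⊎
      (∃[ i ] Σ (Fin (α i ∸ 1)) λ h → At i (suc (toℕ h)) x × T (black i (wide i h) (k ℤ.- + toℕ h)))

    displayed? : ∀ k → Decidable₁ (Displayed k)
    displayed? k x =
      any? (λ j → map′ joint Joint.joint-idx (idx x ≟ after (inject₁ j)) ×-dec T? _) ⊎-dec
      any? (λ i → any? λ h → at? i (suc (toℕ h)) x ×-dec T? _)

    columns : ℤ → Subset n
    columns k = subsetOf (displayed? k)

    data Marks (x : Fin n) (i : Row) (k : ℤ) : Tile → Set where
      red   : ∀ {j} → Joint j x → Marks x i k (red j k)
      black : ∀ {h l} .{w : 1 < α i} → At i (suc h) x → k ≡ l ℤ.+ + h → Marks x i k (black i w l)

    marks-unique : ∀ {x y i k t} → Marks x i k t → Marks y i k t → x ≡ y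
    marks-unique (red p)              (red q)     = joint-unique p q
    marks-unique (black {l = l} a e)  (black b f) with offset-injective l (trans (sym e) f)
    ... | refl = at-unique a b

    marked : ∀ {x i k} → x ∈ columns k → Segment i x → ∃[ t ] T t × Covers t i k × Marks x i k t
    marked {x} {i} {k} x∈ s with ∈-subsetOf⁻ (displayed? k) x∈
    ... | inj₁ (j , p , tt) = red j k , tt , (joint-on p s , refl) , red p
    ... | inj₂ (i′ , h , a , tt) with interior-row {i′ = i} a (s≤s z≤n , <∸1⇒suc< (toℕ<n h)) s
    ...   | refl = black i _ (k ℤ.- + toℕ h) , tt
            , shows-covers {columns k} (unshared (wide i h) a (<∸1⇒suc< (toℕ<n h)) x∈ (sym (k-m+m k (+ toℕ h))))
            , black a (sym (k-m+m k (+ toℕ h)))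

    -- Comparable elements share a row, so both are marked by the tile over the same square;
    -- exactness makes that one tile, and a tile marks at most one element per column.
    columns-antichain : ∀ k → IsAntichain _⊑_ (columns k)
    columns-antichain k x∈ y∈ x⊑y with common-row x⊑y
    ... | i , _ , _ , a , b , _ with marked {i = i} x∈ (at-segment a) | marked {i = i} y∈ (at-segment b)
    ...   | _ , tt , c , m | _ , tt′ , c′ , m′ with same-tile tt c tt′ c′
    ...     | refl = marks-unique m m′

    T-shows : ∀ {t i k} → T t → Covers t i k → Shows (columns k) i k t
    T-shows {yellow i k} tt c@(refl , refl) = none λ (x , s , x∈) → case-marked (marked {i = i} x∈ s)
      where
      case-marked : ∀ {x} → ¬ (∃[ t ] T t × Covers t i k × Marks x i k t)
      case-marked (_ , tt′ , c′ , m) with same-tile tt c tt′ c′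
      case-marked (_ , tt′ , c′ , ()) | refl
    T-shows {red j k} tt (on , refl) = let x , p = joint-exists j in
      shared p on (∈-subsetOf⁺ (displayed? k) (inj₁ (j , p , tt)))
    T-shows {black i w l} {k = k} tt (refl , l≤k , k<) with ≤⇒offset l≤k
    ... | h , refl with offset-< l k<
    ...   | h< with at-exists {i} {suc h} (s≤s z≤n) (<∸1⇒suc< h<)
    ...     | x , a = unshared w a (<∸1⇒suc< h<) (∈-subsetOf⁺ (displayed? k) (inj₂ (i , fromℕ< h< ,
                subst (λ m → At i (suc m) x) (sym (toℕ-fromℕ< h<)) a ,
                subst (λ z → T (black i w z)) (sym start) tt))) refl
      where
      start : l ℤ.+ + h ℤ.- + toℕ (fromℕ< h<) ≡ l
      start = trans (cong (λ m → l ℤ.+ + h ℤ.- + m) (toℕ-fromℕ< h<)) (k+m-m l (+ h))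

    -- Exactness provides some tile over the square; `T-shows` says that it is shown, and only one
    -- tile can be shown there.
    T-shown : ∀ {t i k} → Shows (columns k) i k t → T t
    T-shown {i = i} {k} sh with exact i k
    ... | _ , (tt , c) , _ with shows-unique (columns-antichain k) (T-shows tt c) sh
    ...   | refl = tt

    T-picture : IsPicture T columns
    T-picture = record { antichains = columns-antichain ; shows = T-shows ; shown = T-shown }

    column : ℤ → Antichain
    column k = ⟨ columns k , columns-antichain k ⟩

    -- Both sides satisfy the local rules after column `k`, so determinism gives the two inclusions.
    ρ-column : ∀ k → ρ (column k) ≡ column (k ℤ.+ + 1)
    ρ-column k = elements-injective (⊆-antisym
      (next-deterministic (ρ-next (column k)) tiling-next (antichain (ρ (column k))))
      (next-deterministic tiling-next (ρ-next (column k)) (columns-antichain (k ℤ.+ + 1))))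
      where
      tiling-next : Next (columns k) (columns (k ℤ.+ + 1))
      tiling-next = TilingToRules.tiling-next T-picture isT k

    column-ρ⁻¹ : ∀ k → column k ≡ ρ⁻¹ (column (k ℤ.+ + 1))
    column-ρ⁻¹ k = trans (sym (ρ⁻¹∘ρ (column k))) (cong ρ⁻¹ (ρ-column k))

    ρ^-column : ∀ k → ρ^ k (column (+ 0)) ≡ column k
    ρ^-column (+ zero)      = refl
    ρ^-column (+ suc k)     = trans (cong ρ (ρ^-column (+ k)))
      (trans (ρ-column (+ k)) (cong (column ∘ +_) (+-comm k 1)))
    ρ^-column -[1+ zero ]   = sym (column-ρ⁻¹ -[1+ zero ])
    ρ^-column -[1+ suc k ]  = trans (cong ρ⁻¹ (ρ^-column -[1+ k ])) (sym (column-ρ⁻¹ -[1+ suc k ]))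

    φ-column : φ α (column (+ 0)) ∼ T
    φ-column = + 0 , λ t → mk⇔
      (λ q → subst T (sym (translate-0 t)) (pictures-agree φP T-picture same q))
      (λ q → pictures-agree T-picture φP (sym ∘ same) (subst T (translate-0 t) q))
      where
      φP = OrbitPicture.φ-picture (column (+ 0))
      same : ∀ k → elements (ρ^ k (column (+ 0))) ≡ columns k
      same k = cong elements (ρ^-column k)

lemma2p2 : ∀ {r} (α : Fin (suc r) → ℕ) →
    (∀ i → 1 ≤ α i) → 2 ≤ α zero → 2 ≤ α (fromℕ r) →
    Σ (∀ A → Tilings.IsTiling α (φ α A)) λ φ-isTiling →
    IsBijection (Setoid._≈_ (Fence.Orbits α))
    (Setoid._≈_ (Tilings.AlphaTilings α))
    (λ A → φ α A , φ-isTiling A)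
lemma2p2 α α-pos _ _ = OrbitPicture.φ-isTiling , record
  { isInjection = record
    { isCongruent = record
      { cong           = φ-cong
      ; isEquivalence₁ = Setoid.isEquivalence (Fence.Orbits α)
      ; isEquivalence₂ = Setoid.isEquivalence AlphaTilings
      }
    ; injective = φ-injective
    }
  -- Surjectivity of setoid maps asks about every `B` in the orbit of `A`, hence the passage through
  -- `φ-cong`.
  ; surjective = λ (T , isT) → let A = TilingOrbit.column isT (+ 0) in
      A , λ {B} B≈A → ∼-trans {φ α B} {φ α A} {T} (φ-cong B≈A) (TilingOrbit.φ-column isT)
  }
  where
  open Bijection α α-pos
  open Tilings α
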